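{- Let $k, n, r, s$ be non-negative integers with $n \geq r(k-1)+1$, $k > s \geq 0$ and $r \geq 2$. Then the chromatic number of the generalized Kneser hypergraph satisfies $$\chi\left(KG^{r}(n,k,s)\right) \geq \left\lceil \frac{n - r(k-s-1)}{r-1} \right\rceil.$$
   Context: For a positive integer $n$, $[n]=\{1,\ldots,n\}$. The generalized Kneser hypergraph $KG^{r}(n,k,s)$ has as vertices all $k$-subsets of $[n]$, and as edges all sets $\{X_1,\ldots,X_r\}$ of $r$ distinct $k$-subsets of $[n]$ such that $|X_i \cap X_j| \leq s$ for all $i \neq j$. A proper $m$-coloring of a hypergraph is a map from its vertex set to $\{1,\ldots,m\}$ under which no edge is monochromatic (every edge receives at least two colors); the chromatic number $\chi$ is the least $m$ for which a proper $m$-coloring exists. -}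

module Defs where

open import Data.Nat using (ℕ; zero; suc; _+_; _*_; _∸_; _≤_; _/_)
open import Data.Fin using (Fin)
open import Data.Fin.Subset using (Subset; ∣_∣; _∩_)
open import Data.Product using (Σ; _×_; _,_; proj₁)
open import Relation.Binary.PropositionalEquality using (_≡_)
open import Relation.Nullary using (¬_)

Vertex : ℕ → ℕ → Set
Vertex n k = Σ (Subset n) (λ X → ∣ X ∣ ≡ k)

-- An edge of KG^r(n,k,s): r pairwise distinct k-subsets X_1..X_r with
-- |X_i ∩ X_j| ≤ s for all i ≠ j.  (Presented as an indexed family Fin r → Vertex;
-- the edge is the set of its values.)
IsEdge : (n k s r : ℕ) → (Fin r → Vertex n k) → Set
IsEdge n k s r X =
  ∀ (i j : Fin r) → ¬ (i ≡ j) →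
    ¬ (proj₁ (X i) ≡ proj₁ (X j)) × ∣ proj₁ (X i) ∩ proj₁ (X j) ∣ ≤ s

Monochromatic : {n k r m : ℕ} → (Vertex n k → Fin m) → (Fin r → Vertex n k) → Set
Monochromatic {r = r} c X = ∀ (i j : Fin r) → c (X i) ≡ c (X j)

ProperColoring : (n k s r m : ℕ) → (Vertex n k → Fin m) → Set
ProperColoring n k s r m c =
  ∀ (X : Fin r → Vertex n k) → IsEdge n k s r X → ¬ Monochromatic c X

ChromaticAtLeast : (n k s r b : ℕ) → Set
ChromaticAtLeast n k s r b =
  ∀ (m : ℕ) (c : Vertex n k → Fin m) → ProperColoring n k s r m c → b ≤ m

-- ceiling division by a positive divisor (suc d): ⌈ a / (suc d) ⌉
ceilDiv : ℕ → ℕ → ℕ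
ceilDiv a d = (a + d) / suc d

{-# OPTIONS --safe #-}

-- For prime r = p, apply the topological method to sign vectors X ∈ (ℤ/p ∪ {0})ⁿ \ {0}.  If X has
-- more than α = p (k − s − 1) nonzero entries, some class X_z has at least k − s elements and leaves
-- at least k elements outside the other classes (this needs n ≥ p (k − 1) + 1); label X by z and by
-- the colour of a k-set F that avoids the other classes and has at least k − s elements in X_z.  If
-- X ≤ Y get different signs and the same colour, then the set chosen for Y avoids X_z, so the two sets
-- share at most s elements.  Hence in a proper colouring a chain never carries all p signs with the
-- same colour, and sending a chain to its set of labels maps to a poset of rank α + m (p − 1) on
-- which ℤ/p acts freely.
--
-- That n ≤ α + m (p − 1) is then a Borsuk–Ulam statement, proved with integral cochains on tuples: a
-- chain x_j of the iterated join of ℤ/p with ∂ x_(j+1) = (g − 1) x_j or (1 + g + ⋯ + g^(p−1)) x_j,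
-- subdivided twice, is paired with pullbacks along an equivariant map to ℤ/p of the powers of the
-- degree-2 class of ℤ/p.  The pairing is ±1 modulo p in all degrees, but these cocycles vanish on
-- tuples in which consecutive labels agree.
--
-- A product r₁ r₂ with r₁ ≤ r₂ is reduced to its factors by colouring larger subsets N ⊆ [n] with the
-- colour of a monochromatic edge of KG^r₂ inside N.
module Submission where

open import Defs
open import Data.Nat using (ℕ; suc; _+_; _*_; _∸_; _≤_; _<_)
import Data.Nat.Properties as ℕₚ
open import Algebra.Properties.CommutativeMonoid.Sum ℕₚ.+-0-commutativeMonoid using (sum; sum-cong-≗; ∑-distrib-+; ∑-comm; sum-permute)
open import Data.Bool.Base using (Bool; true; false; if_then_else_; _∧_; _∨_)
open import Data.Bool.Properties using (∨-zeroʳ; ¬-not) renaming (_≟_ to _≟ᵇ_)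
open import Data.Fin.Base using (Fin; zero; suc; toℕ; fromℕ<; remQuot; combine)
open import Data.Fin.Permutation using (permutation)
import Data.Fin.Properties as Finₚ
open import Data.Fin.Subset using (Subset; inside; outside; ∣_∣; _∩_; ∁) renaming (_∈_ to _∈ₛ_; _∉_ to _∉ₛ_; _⊆_ to _⊆ₛ_; ⊥ to ∅)
open import Data.Fin.Subset.Properties using (p⊆q⇒∣p∣≤∣q∣; x∈p∩q⁺; x∈p∩q⁻; x∉p⇒x∈∁p; drop-∷-⊆; ∣⊥∣≡0; ⊥⊆; ∩-idem; ∩-comm)
open import Data.Integer.Base using (ℤ; 0ℤ; 1ℤ; -_; +_) renaming (_+_ to _+ᶻ_; _-_ to _-ᶻ_; _*_ to _*ᶻ_; ∣_∣ to ∣_∣ᶻ)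
import Data.Integer.Properties as ℤₚ
open import Data.Integer.Tactic.RingSolver using () renaming (solve-∀ to ring-ℤ)
open import Data.List.Base using (List; []; _∷_; map; length; downFrom)
open import Data.List.Membership.Propositional using (_∈_)
open import Data.List.NonEmpty.Base as List⁺ using (List⁺; toList) renaming (_∷_ to _∷⁺_)
open import Data.List.Properties using (map-cong; map-∘; map-id; length-map; ∷-injectiveˡ; ∷-injectiveʳ)
open import Data.List.Relation.Binary.Equality.Propositional using (≋⇒≡)
open import Data.List.Relation.Binary.Sublist.Heterogeneous.Properties using (toPointwise)
open import Data.List.Relation.Binary.Sublist.Propositional using (_⊆_; []; _∷_; _∷ʳ_; ⊆-refl; ⊆-trans) renaming (lookup to ⊆-lookup)
open import Data.List.Relation.Binary.Sublist.Propositional.Properties using (All-resp-⊆)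
open import Data.List.Relation.Unary.All as All using (All; []; _∷_)
open import Data.List.Relation.Unary.AllPairs using (AllPairs; []; _∷_)
open import Data.List.Relation.Unary.Any using (Any; here; there)
open import Data.Maybe.Base as Maybe using (Maybe; just; nothing)
open import Data.Nat.Base using (zero; s≤s; z≤n; _%_; _/_; _⊔_; >-nonZero; nonTrivial⇒n>1; n>1⇒nonTrivial)
open import Data.Nat.Coprimality using (coprime-Bézout; prime⇒coprime)
open import Data.Nat.Divisibility using (divides)
open import Data.Nat.DivMod using (_mod_; m%n<n; m<n⇒m%n≡m; n%n≡0; [m+n]%n≡m%n; [m+kn]%n≡m%n; %-distribˡ-+; m%n%n≡m%n; m/n*n≤m)
open import Data.Nat.GCD using (module Bézout)
open import Data.Nat.Induction using (<-rec)
open import Data.Nat.Primality using (Prime; prime?; prime⇒nonTrivial; ¬prime⇒composite; composite)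
open ℕₚ using (_≟_; _<?_; _≤?_)
open import Data.Nat.Tactic.RingSolver using () renaming (solve-∀ to ring-ℕ)
open import Data.Product.Base using (Σ; ∃; _×_; _,_; proj₁; proj₂; map₂)
open import Data.Sum.Base using (_⊎_; inj₁; inj₂; [_,_]′)
open import Data.Unit.Base using (⊤; tt)
open import Data.Vec.Base using ([]; _∷_; here; there; tabulate)
open import Data.Vec.Properties using (lookup∘tabulate; tabulate-cong; lookup⇒[]=; []=⇒lookup)
open import Relation.Binary.PropositionalEquality using (_≡_; _≢_; _≗_; refl; sym; trans; cong; cong₂; subst; subst₂; module ≡-Reasoning)
open import Relation.Nullary using (¬_; Dec; does; yes; no; contradiction)
open import Relation.Nullary.Decidable using (dec-true; dec-false)

-- Integral cochains on tuples, and linear operators between them.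

Cochain : Set → Set
Cochain A = A → ℤ

-- The simplicial coboundary, augmented: the empty tuple counts as a simplex, so on a one-point
-- tuple the value is `φ []`. The recursion separates deletion of the first vertex from the other
-- deletions.
δ : {V : Set} → Cochain (List V) → Cochain (List V)
δ φ []      = 0ℤ
δ φ (v ∷ t) = φ t -ᶻ δ (λ u → φ (v ∷ u)) t

δ-local : ∀ {V : Set} {φ ψ : Cochain (List V)} t →
          (∀ u → u ⊆ t → φ u ≡ ψ u) → δ φ t ≡ δ ψ t
δ-local []      eq = refl
δ-local (v ∷ t) eq = cong₂ _-ᶻ_ (eq t (v ∷ʳ ⊆-refl)) (δ-local t λ u u⊆t → eq (v ∷ u) (refl ∷ u⊆t))

δ-cong : ∀ {V : Set} {φ ψ : Cochain (List V)} → φ ≗ ψ → δ φ ≗ δ ψ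
δ-cong eq t = δ-local t λ u _ → eq u

private
  rearrange-sub : ∀ a b c d → (a -ᶻ b) -ᶻ (c -ᶻ d) ≡ (a -ᶻ c) -ᶻ (b -ᶻ d)
  rearrange-sub = ring-ℤ

δ-sub : ∀ {V : Set} (φ ψ : Cochain (List V)) t →
        δ (λ u → φ u -ᶻ ψ u) t ≡ δ φ t -ᶻ δ ψ t
δ-sub φ ψ []      = refl
δ-sub φ ψ (v ∷ t) =
  trans (cong (φ t -ᶻ ψ t -ᶻ_) (δ-sub (λ u → φ (v ∷ u)) (λ u → ψ (v ∷ u)) t))
        (rearrange-sub (φ t) (ψ t) _ _)

δ-zero : ∀ {V : Set} t → δ {V} (λ _ → 0ℤ) t ≡ 0ℤ
δ-zero []      = refl
δ-zero (v ∷ t) = cong (0ℤ -ᶻ_) (δ-zero t)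

δ-δ : ∀ {V : Set} (φ : Cochain (List V)) t → δ (δ φ) t ≡ 0ℤ
δ-δ φ []      = refl
δ-δ φ (v ∷ t) = begin
  δ φ t -ᶻ δ (λ u → φ u -ᶻ δ φᵥ u) t       ≡⟨ cong (δ φ t -ᶻ_) (δ-sub φ (δ φᵥ) t) ⟩
  δ φ t -ᶻ (δ φ t -ᶻ δ (δ φᵥ) t)           ≡⟨ cong (λ z → δ φ t -ᶻ (δ φ t -ᶻ z)) (δ-δ φᵥ t) ⟩
  δ φ t -ᶻ (δ φ t -ᶻ 0ℤ)                   ≡⟨ lemma (δ φ t) ⟩
  0ℤ                                       ∎
  where
  open ≡-Reasoning
  φᵥ = λ u → φ (v ∷ u)
  lemma : ∀ a → a -ᶻ (a -ᶻ 0ℤ) ≡ 0ℤ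
  lemma = ring-ℤ

δ-map : ∀ {V W : Set} (f : V → W) (φ : Cochain (List W)) t →
        δ (λ u → φ (map f u)) t ≡ δ φ (map f t)
δ-map f φ []      = refl
δ-map f φ (v ∷ t) = cong (φ (map f t) -ᶻ_) (δ-map f (λ u → φ (f v ∷ u)) t)

-- Cochains are compared pointwise, so respecting `≗` is part of linearity. Compatibility with zero
-- and with sums follows from subtraction.
record Linear {A B : Set} (F : Cochain A → Cochain B) : Set where
  field
    ≗-cong : ∀ {φ ψ} → φ ≗ ψ → F φ ≗ F ψ
    sub    : ∀ φ ψ b → F (λ a → φ a -ᶻ ψ a) b ≡ F φ b -ᶻ F ψ b

  zero-pres : ∀ {φ} → (∀ a → φ a ≡ 0ℤ) → ∀ b → F φ b ≡ 0ℤ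
  zero-pres {φ} φ≡0 b =
    trans (≗-cong (λ a → trans (φ≡0 a) (sym (ℤₚ.+-inverseʳ (φ a)))) b)
          (trans (sub φ φ b) (ℤₚ.+-inverseʳ (F φ b)))

  add : ∀ φ ψ b → F (λ a → φ a +ᶻ ψ a) b ≡ F φ b +ᶻ F ψ b
  add φ ψ b = begin
    F (λ a → φ a +ᶻ ψ a) b                     ≡⟨ lemma₁ _ _ ⟩
    (F (λ a → φ a +ᶻ ψ a) b -ᶻ F ψ b) +ᶻ F ψ b ≡⟨ cong (_+ᶻ F ψ b) (sub _ ψ b) ⟨
    F (λ a → φ a +ᶻ ψ a -ᶻ ψ a) b +ᶻ F ψ b     ≡⟨ cong (_+ᶻ F ψ b) (≗-cong (λ a → lemma₂ (φ a) (ψ a)) b) ⟩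
    F φ b +ᶻ F ψ b                             ∎
    where
    open ≡-Reasoning
    lemma₁ : ∀ x y → x ≡ (x -ᶻ y) +ᶻ y
    lemma₁ = ring-ℤ
    lemma₂ : ∀ x y → x +ᶻ y -ᶻ y ≡ x
    lemma₂ = ring-ℤ

open Linear

δ-linear : {V : Set} → Linear (δ {V})
δ-linear = record { ≗-cong = δ-cong ; sub = δ-sub }

∘-linear : ∀ {A B C : Set} {F : Cochain B → Cochain C} {G : Cochain A → Cochain B} →
           Linear F → Linear G → Linear (λ φ → F (G φ))
∘-linear L M = record
  { ≗-cong = λ eq → ≗-cong L (≗-cong M eq)
  ; sub    = λ φ ψ c → trans (≗-cong L (sub M φ ψ) c) (sub L _ _ c)
  }

precompose-linear : ∀ {A B : Set} (f : B → A) → Linear (λ φ b → φ (f b))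
precompose-linear f = record { ≗-cong = λ eq b → eq (f b) ; sub = λ φ ψ b → refl }

Σ< : ℕ → (ℕ → ℤ) → ℤ
Σ< zero    f = 0ℤ
Σ< (suc a) f = Σ< a f +ᶻ f a

Σ<-cong : ∀ a {f h} → f ≗ h → Σ< a f ≡ Σ< a h
Σ<-cong zero    eq = refl
Σ<-cong (suc a) eq = cong₂ _+ᶻ_ (Σ<-cong a eq) (eq a)

Σ<-sub : ∀ a f h → Σ< a (λ i → f i -ᶻ h i) ≡ Σ< a f -ᶻ Σ< a h
Σ<-sub zero    f h = refl
Σ<-sub (suc a) f h = trans (cong (_+ᶻ (f a -ᶻ h a)) (Σ<-sub a f h)) (lemma (Σ< a f) (Σ< a h) (f a) (h a))
  where
  lemma : ∀ x y z w → (x -ᶻ y) +ᶻ (z -ᶻ w) ≡ (x +ᶻ z) -ᶻ (y +ᶻ w)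
  lemma = ring-ℤ

Σ<-telescope : ∀ a (f : ℕ → ℤ) → Σ< a (λ i → f (suc i) -ᶻ f i) ≡ f a -ᶻ f 0
Σ<-telescope zero    f = sym (ℤₚ.+-inverseʳ (f 0))
Σ<-telescope (suc a) f = trans (cong (_+ᶻ (f (suc a) -ᶻ f a)) (Σ<-telescope a f)) (lemma (f a) (f 0) (f (suc a)))
  where
  lemma : ∀ x y z → (x -ᶻ y) +ᶻ (z -ᶻ x) ≡ z -ᶻ y
  lemma = ring-ℤ

linear-Σ< : ∀ {A B : Set} {F : Cochain A → Cochain B} → Linear F → ∀ a (φ : ℕ → Cochain A) b →
            F (λ x → Σ< a (λ i → φ i x)) b ≡ Σ< a (λ i → F (φ i) b)
linear-Σ< L zero    φ b = zero-pres L (λ _ → refl) b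
linear-Σ< {F = F} L (suc a) φ b =
  trans (add L (λ x → Σ< a (λ i → φ i x)) (φ a) b) (cong (_+ᶻ F (φ a) b) (linear-Σ< L a φ b))

-- Iterates and the periodic resolution of a cyclic group.

_^_ : {A : Set} → (A → A) → ℕ → A → A
(g ^ zero)  x = x
(g ^ suc a) x = g ((g ^ a) x)

^-shift : ∀ {A : Set} (g : A → A) a x → (g ^ a) (g x) ≡ g ((g ^ a) x)
^-shift g zero    x = refl
^-shift g (suc a) x = cong g (^-shift g a x)

^-natural : ∀ {A B : Set} {g : A → A} {h : B → B} {f : A → B} → (∀ x → f (g x) ≡ h (f x)) →
            ∀ a x → f ((g ^ a) x) ≡ (h ^ a) (f x)
^-natural nat zero    x = refl
^-natural {h = h} nat (suc a) x = trans (nat _) (cong h (^-natural nat a x))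

module Resolution (p : ℕ) where

  -- The differentials of the periodic resolution of a cyclic group of order p:
  -- g − 1 in even degrees and 1 + g + ⋯ + g^(p−1) in odd degrees.
  D : {A : Set} → (A → A) → ℕ → Cochain A → Cochain A
  D g zero          φ x = φ (g x) -ᶻ φ x
  D g (suc zero)    φ x = Σ< p (λ a → φ ((g ^ a) x))
  D g (suc (suc j)) φ x = D g j φ x

  D-linear : ∀ {A : Set} (g : A → A) j → Linear (D g j)
  D-linear g zero          = record
    { ≗-cong = λ eq x → cong₂ _-ᶻ_ (eq (g x)) (eq x)
    ; sub    = λ φ ψ x → rearrange-sub (φ (g x)) (ψ (g x)) (φ x) (ψ x)
    }
  D-linear g (suc zero)    = record
    { ≗-cong = λ eq x → Σ<-cong p (λ a → eq ((g ^ a) x))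
    ; sub    = λ φ ψ x → Σ<-sub p _ _
    }
  D-linear g (suc (suc j)) = record { ≗-cong = ≗-cong (D-linear g j) ; sub = sub (D-linear g j) }

  -- Both composites telescope along an orbit to g^p - 1, which is zero.
  D-D : ∀ {A : Set} (g : A → A) → (∀ x → (g ^ p) x ≡ x) →
        ∀ j φ x → D g j (D g (suc j) φ) x ≡ 0ℤ
  D-D g gᵖ≡1 zero φ x = begin
    Σ< p (λ a → φ ((g ^ a) (g x))) -ᶻ Σ< p (λ a → φ ((g ^ a) x))
      ≡⟨ Σ<-sub p _ _ ⟨
    Σ< p (λ a → φ ((g ^ a) (g x)) -ᶻ φ ((g ^ a) x))
      ≡⟨ Σ<-cong p (λ a → cong (λ y → φ y -ᶻ φ ((g ^ a) x)) (^-shift g a x)) ⟩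
    Σ< p (λ a → φ ((g ^ suc a) x) -ᶻ φ ((g ^ a) x))
      ≡⟨ Σ<-telescope p (λ a → φ ((g ^ a) x)) ⟩
    φ ((g ^ p) x) -ᶻ φ x
      ≡⟨ cong (λ y → φ y -ᶻ φ x) (gᵖ≡1 x) ⟩
    φ x -ᶻ φ x
      ≡⟨ ℤₚ.+-inverseʳ (φ x) ⟩
    0ℤ ∎
    where open ≡-Reasoning
  D-D g gᵖ≡1 (suc zero) φ x =
    trans (Σ<-telescope p (λ a → φ ((g ^ a) x)))
          (trans (cong (λ y → φ y -ᶻ φ x) (gᵖ≡1 x)) (ℤₚ.+-inverseʳ (φ x)))
  D-D g gᵖ≡1 (suc (suc j)) φ x = D-D g gᵖ≡1 j φ x

  -- The differentials are integral combinations of powers of the action, so intertwining `g` with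
  -- `h` is enough. It serves for `δ` and for subdivision.
  D-natural : ∀ {A B : Set} {g : A → A} {h : B → B} {F : Cochain A → Cochain B} → Linear F →
              (∀ φ b → F (λ a → φ (g a)) b ≡ F φ (h b)) →
              ∀ j φ b → F (D g j φ) b ≡ D h j (F φ) b
  D-natural {F = F} L nat zero φ b = trans (sub L _ φ b) (cong (_-ᶻ F φ b) (nat φ b))
  D-natural {g = g} {h} {F} L nat (suc zero) φ b =
    trans (linear-Σ< L p (λ a x → φ ((g ^ a) x)) b) (Σ<-cong p (λ a → iterate a φ))
    where
    iterate : ∀ a φ → F (λ x → φ ((g ^ a) x)) b ≡ F φ ((h ^ a) b)
    iterate zero    φ = refl
    iterate (suc a) φ = trans (iterate a (λ x → φ (g x))) (nat φ ((h ^ a) b))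
  D-natural L nat (suc (suc j)) φ b = D-natural L nat j φ b

-- Barycentric subdivision

-- The dual of the recursion sd t = t · sd (∂ t), where v · u prepends the vertex v to u; the first
-- argument is the length of t.
sd : {V : Set} → ℕ → Cochain (List (List⁺ V)) → Cochain (List V)
sd zero    φ t       = φ []
sd (suc d) φ []      = 0ℤ
sd (suc d) φ (v ∷ t) = δ (sd d (λ u → φ ((v ∷⁺ t) ∷ u))) (v ∷ t)

sd-linear : ∀ {V : Set} d → Linear (sd {V} d)
sd-linear {V} d = record { ≗-cong = λ eq t → cong-sd d eq t ; sub = sub-sd d }
  where
  cong-sd : ∀ d {φ ψ} → φ ≗ ψ → sd {V} d φ ≗ sd d ψ
  cong-sd zero    eq t       = eq []
  cong-sd (suc d) eq []      = refl
  cong-sd (suc d) eq (v ∷ t) = δ-cong (cong-sd d (λ u → eq _)) (v ∷ t)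

  sub-sd : ∀ d φ ψ t → sd {V} d (λ u → φ u -ᶻ ψ u) t ≡ sd d φ t -ᶻ sd d ψ t
  sub-sd zero    φ ψ t       = refl
  sub-sd (suc d) φ ψ []      = refl
  sub-sd (suc d) φ ψ (v ∷ t) = 
    trans (δ-cong (sub-sd d (λ u → φ ((v ∷⁺ t) ∷ u)) (λ u → ψ ((v ∷⁺ t) ∷ u))) (v ∷ t))
          (δ-sub (sd d (λ u → φ ((v ∷⁺ t) ∷ u))) (sd d (λ u → ψ ((v ∷⁺ t) ∷ u))) (v ∷ t))

-- Dually, sd t is a cone over sd (∂ t), so its boundary is sd (∂ t) minus the cone over ∂ (sd (∂
-- t)). The last term vanishes by the statement one degree lower and ∂ ∂ = 0.
sd-δ : ∀ {V : Set} d (φ : Cochain (List (List⁺ V))) t → sd (suc d) (δ φ) t ≡ δ (sd d φ) t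
sd-δ d φ []      = refl
sd-δ d φ (v ∷ t) = begin
  δ (sd d (λ u → φ u -ᶻ δ ψ u)) (v ∷ t)                ≡⟨ δ-cong (sub (sd-linear d) φ (δ ψ)) (v ∷ t) ⟩
  δ (λ s → sd d φ s -ᶻ sd d (δ ψ) s) (v ∷ t)           ≡⟨ δ-sub (sd d φ) (sd d (δ ψ)) (v ∷ t) ⟩
  δ (sd d φ) (v ∷ t) -ᶻ δ (sd d (δ ψ)) (v ∷ t)         ≡⟨ cong (δ (sd d φ) (v ∷ t) -ᶻ_) (vanish d ψ) ⟩
  δ (sd d φ) (v ∷ t) -ᶻ 0ℤ                             ≡⟨ ℤₚ.+-identityʳ _ ⟩
  δ (sd d φ) (v ∷ t)                                   ∎
  where
  open ≡-Reasoning
  ψ = λ u → φ ((v ∷⁺ t) ∷ u)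
  vanish : ∀ d ψ → δ (sd d (δ ψ)) (v ∷ t) ≡ 0ℤ
  -- In degree zero `sd` reads only the value at the empty tuple, where every coboundary is `0ℤ`.
  vanish zero    ψ = δ-zero (v ∷ t)
  vanish (suc d) ψ = trans (δ-cong (sd-δ d ψ) (v ∷ t)) (δ-δ (sd d ψ) (v ∷ t))

sd-map : ∀ {V W : Set} (f : V → W) d (φ : Cochain (List (List⁺ W))) t →
         sd d (λ u → φ (map (List⁺.map f) u)) t ≡ sd d φ (map f t)
sd-map f zero    φ t       = refl
sd-map f (suc d) φ []      = refl
sd-map f (suc d) φ (v ∷ t) =
  trans (δ-cong (sd-map f d ψ) (v ∷ t)) (δ-map f (sd d ψ) (v ∷ t))
  where ψ = λ u → φ (List⁺.map f (v ∷⁺ t) ∷ u)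

Flag : {V : Set} → List V → List (List⁺ V) → Set
Flag t []      = ⊤
Flag t (w ∷ u) = toList w ⊆ t × Flag (toList w) u

-- Unfolding `sd` puts the whole tuple first and continues with the subdivision of its faces, so
-- only descending sequences of subtuples are ever evaluated.
sd-local-zero : ∀ {V : Set} d (φ : Cochain (List (List⁺ V))) t →
                (∀ u → length u ≡ d → Flag t u → φ u ≡ 0ℤ) → sd d φ t ≡ 0ℤ
sd-local-zero zero    φ t       z = z [] refl tt
sd-local-zero (suc d) φ []      z = refl
sd-local-zero (suc d) φ (v ∷ t) z =
  trans (δ-local (v ∷ t) λ s s⊆ → sd-local-zero d _ s λ u eq fl →
           z ((v ∷⁺ t) ∷ u) (cong suc eq) (⊆-refl , weaken u s⊆ fl))
        (δ-zero (v ∷ t))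
  where
  weaken : ∀ {V : Set} {s t : List V} u → s ⊆ t → Flag s u → Flag t u
  weaken []      s⊆t fl         = tt
  weaken (w ∷ u) s⊆t (w⊆ , fl) = ⊆-trans w⊆ s⊆t , fl

-- The generator of ℤ/p acting on labels.

rot : ∀ {q} → Fin (suc q) → Fin (suc q)
rot {q} i = suc (toℕ i) mod suc q

toℕ-rot : ∀ {q} (i : Fin (suc q)) → toℕ (rot i) ≡ suc (toℕ i) % suc q
toℕ-rot {q} i = Finₚ.toℕ-fromℕ< _

data RotView {q} (i : Fin (suc q)) : Set where
  wraps : toℕ i ≡ q → toℕ (rot i) ≡ 0 → RotView i
  steps : toℕ i < q → toℕ (rot i) ≡ suc (toℕ i) → RotView i

rotView : ∀ {q} (i : Fin (suc q)) → RotView i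
rotView {q} i with ℕₚ.m≤n⇒m<n∨m≡n (ℕₚ.≤-pred (Finₚ.toℕ<n i))
... | inj₁ i<q = steps i<q (trans (toℕ-rot i) (m<n⇒m%n≡m (s≤s i<q)))
... | inj₂ i≡q = wraps i≡q (trans (toℕ-rot i) (trans (cong (λ a → suc a % suc q) i≡q) (n%n≡0 (suc q))))

rot-injective : ∀ {q} {i j : Fin (suc q)} → rot i ≡ rot j → i ≡ j
rot-injective {q} {i} {j} eq with rotView i | rotView j
... | wraps i≡ _ | wraps j≡ _ = Finₚ.toℕ-injective (trans i≡ (sym j≡))
... | wraps _ ri | steps _ rj = contradiction (trans (sym ri) (trans (cong toℕ eq) rj)) λ ()
... | steps _ ri | wraps _ rj = contradiction (trans (sym rj) (trans (cong toℕ (sym eq)) ri)) λ ()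
... | steps _ ri | steps _ rj = Finₚ.toℕ-injective (ℕₚ.suc-injective (trans (sym ri) (trans (cong toℕ eq) rj)))

toℕ-rot^ : ∀ {q} a (i : Fin (suc q)) → toℕ ((rot ^ a) i) ≡ (a + toℕ i) % suc q
toℕ-rot^ {q} zero    i = sym (m<n⇒m%n≡m (Finₚ.toℕ<n i))
toℕ-rot^ {q} (suc a) i = begin
  toℕ (rot ((rot ^ a) i))                                  ≡⟨ toℕ-rot ((rot ^ a) i) ⟩
  (1 + toℕ ((rot ^ a) i)) % suc q                          ≡⟨ cong (λ x → suc x % suc q) (toℕ-rot^ a i) ⟩
  (1 + (a + toℕ i) % suc q) % suc q                        ≡⟨ %-distribˡ-+ 1 _ (suc q) ⟩
  (1 % suc q + (a + toℕ i) % suc q % suc q) % suc q        ≡⟨ cong (λ x → (1 % suc q + x) % suc q) (m%n%n≡m%n (a + toℕ i) (suc q)) ⟩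
  (1 % suc q + (a + toℕ i) % suc q) % suc q                ≡⟨ %-distribˡ-+ 1 (a + toℕ i) (suc q) ⟨
  (suc a + toℕ i) % suc q                                  ∎
  where open ≡-Reasoning

rot^p≡id : ∀ {q} (i : Fin (suc q)) → (rot ^ suc q) i ≡ i
rot^p≡id {q} i = Finₚ.toℕ-injective (begin
  toℕ ((rot ^ suc q) i)    ≡⟨ toℕ-rot^ (suc q) i ⟩
  (suc q + toℕ i) % suc q  ≡⟨ cong (_% suc q) (ℕₚ.+-comm (suc q) (toℕ i)) ⟩
  (toℕ i + suc q) % suc q  ≡⟨ [m+n]%n≡m%n (toℕ i) (suc q) ⟩
  toℕ i % suc q            ≡⟨ m<n⇒m%n≡m (Finₚ.toℕ<n i) ⟩
  toℕ i                    ∎)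
  where open ≡-Reasoning

indicator : Bool → ℤ
indicator b = if b then 1ℤ else 0ℤ

[_≺_] : ∀ {q} → Fin (suc q) → Fin (suc q) → ℤ
[ i ≺ j ] = indicator (does (toℕ i <? toℕ j))

[top_] : ∀ {q} → Fin (suc q) → ℤ
[top_] {q} i = indicator (does (toℕ i ≟ q))

private
  lt-yes : ∀ {q} {i j : Fin (suc q)} → toℕ i < toℕ j → [ i ≺ j ] ≡ 1ℤ
  lt-yes {i = i} {j} lt = cong indicator (dec-true (toℕ i <? toℕ j) lt)

  lt-no : ∀ {q} {i j : Fin (suc q)} → toℕ j ≤ toℕ i → [ i ≺ j ] ≡ 0ℤ
  lt-no {i = i} {j} le = cong indicator (dec-false (toℕ i <? toℕ j) (ℕₚ.≤⇒≯ le))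

  top-yes : ∀ {q} {i : Fin (suc q)} → toℕ i ≡ q → [top i ] ≡ 1ℤ
  top-yes {q} {i} eq = cong indicator (dec-true (toℕ i ≟ q) eq)

  top-no : ∀ {q} {i : Fin (suc q)} → toℕ i < q → [top i ] ≡ 0ℤ
  top-no {q} {i} lt = cong indicator (dec-false (toℕ i ≟ q) (ℕₚ.<⇒≢ lt))

[≺]-irrefl : ∀ {q} (i : Fin (suc q)) → [ i ≺ i ] ≡ 0ℤ
[≺]-irrefl i = lt-no {i = i} {i} ℕₚ.≤-refl

-- Rotation changes the order of two labels only if exactly one of them wraps round to 0. The
-- correction is a coboundary of `[top_]`, which is what makes the cocycles `K` invariant although
-- the order is not.
[≺]-rot : ∀ {q} (i j : Fin (suc q)) → [ rot i ≺ rot j ] ≡ [ i ≺ j ] -ᶻ ([top j ] -ᶻ [top i ])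
[≺]-rot {q} i j with rotView i | rotView j
... | wraps i≡ ri | wraps j≡ rj
  rewrite lt-no {i = rot i} {rot j} (ℕₚ.≤-reflexive (trans rj (sym ri)))
        | lt-no {i = i} {j} (ℕₚ.≤-reflexive (trans j≡ (sym i≡)))
        | top-yes {i = i} i≡ | top-yes {i = j} j≡ = refl
... | wraps i≡ ri | steps j< rj
  rewrite lt-yes {i = rot i} {rot j} (subst₂ _<_ (sym ri) (sym rj) (s≤s z≤n))
        | lt-no {i = i} {j} (ℕₚ.<⇒≤ (subst (toℕ j <_) (sym i≡) j<))
        | top-yes {i = i} i≡ | top-no {i = j} j< = refl
... | steps i< ri | wraps j≡ rj
  rewrite lt-no {i = rot i} {rot j} (subst (_≤ toℕ (rot i)) (sym rj) z≤n)
        | lt-yes {i = i} {j} (subst (toℕ i <_) (sym j≡) i<)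
        | top-no {i = i} i< | top-yes {i = j} j≡ = refl
... | steps i< ri | steps j< rj
  rewrite top-no {i = i} i< | top-no {i = j} j<
  with ℕₚ.<-≤-connex (toℕ i) (toℕ j)
...   | inj₁ i<j rewrite lt-yes {i = i} {j} i<j
                       | lt-yes {i = rot i} {rot j} (subst₂ _<_ (sym ri) (sym rj) (s≤s i<j)) = refl
...   | inj₂ j≤i rewrite lt-no {i = i} {j} j≤i
                       | lt-no {i = rot i} {rot j} (subst₂ _≤_ (sym rj) (sym ri) (s≤s j≤i)) = refl

Σ<-const : ∀ a z → Σ< a (λ _ → z) ≡ + a *ᶻ z
Σ<-const zero    z = sym (ℤₚ.*-zeroˡ z)
Σ<-const (suc a) z = begin
  Σ< a (λ _ → z) +ᶻ z     ≡⟨ cong (_+ᶻ z) (Σ<-const a z) ⟩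
  + a *ᶻ z +ᶻ z           ≡⟨ ℤₚ.+-comm (+ a *ᶻ z) z ⟩
  z +ᶻ + a *ᶻ z           ≡⟨ ℤₚ.suc-* (+ a) z ⟨
  + suc a *ᶻ z            ∎
  where open ≡-Reasoning

Σ<-*ˡ : ∀ a z f → Σ< a (λ i → z *ᶻ f i) ≡ z *ᶻ Σ< a f
Σ<-*ˡ zero    z f = sym (ℤₚ.*-zeroʳ z)
Σ<-*ˡ (suc a) z f = trans (cong (_+ᶻ z *ᶻ f a) (Σ<-*ˡ a z f)) (sym (ℤₚ.*-distribˡ-+ z (Σ< a f) (f a)))

Σ<-*ʳ : ∀ a z f → Σ< a (λ i → f i *ᶻ z) ≡ Σ< a f *ᶻ z
Σ<-*ʳ a z f = trans (Σ<-cong a (λ i → ℤₚ.*-comm (f i) z)) (trans (Σ<-*ˡ a z f) (ℤₚ.*-comm z (Σ< a f)))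

toℕ-rot-ℤ : ∀ {q} (i : Fin (suc q)) → + toℕ (rot i) -ᶻ + toℕ i ≡ 1ℤ -ᶻ + suc q *ᶻ [top i ]
toℕ-rot-ℤ {q} i with rotView i
... | wraps i≡ ri rewrite ri | top-yes {i = i} i≡ | i≡ = lemma (+ q)
  where
  lemma : ∀ z → 0ℤ -ᶻ z ≡ 1ℤ -ᶻ (1ℤ +ᶻ z) *ᶻ 1ℤ
  lemma = ring-ℤ
... | steps i< ri rewrite ri | top-no {i = i} i< = lemma (+ toℕ i) (+ suc q)
  where
  lemma : ∀ z w → (1ℤ +ᶻ z) -ᶻ z ≡ 1ℤ -ᶻ w *ᶻ 0ℤ
  lemma = ring-ℤ

-- Sum toℕ-rot-ℤ over the orbit.
Σ-top-orbit : ∀ {q} (i : Fin (suc q)) → Σ< (suc q) (λ a → [top (rot ^ a) i ]) ≡ 1ℤ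
Σ-top-orbit {q} i = ℤₚ.*-cancelˡ-≡ (+ p) _ _ (lemma (+ p) (+ p *ᶻ Σ< p tops) (begin
  + p *ᶻ 1ℤ -ᶻ + p *ᶻ Σ< p tops                                       ≡⟨ cong₂ _-ᶻ_ (Σ<-const p 1ℤ) (Σ<-*ˡ p (+ p) tops) ⟨
  Σ< p (λ _ → 1ℤ) -ᶻ Σ< p (λ a → + p *ᶻ tops a)                        ≡⟨ Σ<-sub p (λ _ → 1ℤ) (λ a → + p *ᶻ tops a) ⟨
  Σ< p (λ a → 1ℤ -ᶻ + p *ᶻ tops a)                                     ≡⟨ Σ<-cong p (λ a → toℕ-rot-ℤ ((rot ^ a) i)) ⟨
  Σ< p (λ a → + toℕ ((rot ^ suc a) i) -ᶻ + toℕ ((rot ^ a) i))          ≡⟨ Σ<-telescope p (λ a → + toℕ ((rot ^ a) i)) ⟩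
  + toℕ ((rot ^ p) i) -ᶻ + toℕ i                                       ≡⟨ cong (λ j → + toℕ j -ᶻ + toℕ i) (rot^p≡id i) ⟩
  + toℕ i -ᶻ + toℕ i                                                   ≡⟨ ℤₚ.+-inverseʳ (+ toℕ i) ⟩
  0ℤ                                                                   ∎))
  where
  open ≡-Reasoning
  p = suc q
  tops = λ a → [top (rot ^ a) i ]
  lemma : ∀ z w → z *ᶻ 1ℤ -ᶻ w ≡ 0ℤ → w ≡ z *ᶻ 1ℤ
  lemma z w eq = sym (ℤₚ.i-j≡0⇒i≡j (z *ᶻ 1ℤ) w eq)

-- Normalised cochains and the cohomology classes of ℤ/p.

data Repeats {A : Set} : List A → Set where
  here  : ∀ {a t} → Repeats (a ∷ a ∷ t)
  there : ∀ {a t} → Repeats t → Repeats (a ∷ t)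

Repeats-map : ∀ {A B : Set} (f : A → B) {t} → Repeats t → Repeats (map f t)
Repeats-map f here      = here
Repeats-map f (there r) = there (Repeats-map f r)

-- Deleting either of two equal neighbours gives the same tuple with opposite signs, and every other
-- deletion keeps the repetition.
δ-normalised : ∀ {A : Set} (φ : Cochain (List A)) → (∀ t → Repeats t → φ t ≡ 0ℤ) →
               ∀ t → Repeats t → δ φ t ≡ 0ℤ
δ-normalised φ nrm (a ∷ .a ∷ t) here = begin
  φ (a ∷ t) -ᶻ (φ (a ∷ t) -ᶻ δ (λ u → φ (a ∷ a ∷ u)) t)
    ≡⟨ cong (λ z → φ (a ∷ t) -ᶻ (φ (a ∷ t) -ᶻ z)) (zero-pres δ-linear (λ u → nrm (a ∷ a ∷ u) here) t) ⟩
  φ (a ∷ t) -ᶻ (φ (a ∷ t) -ᶻ 0ℤ)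
    ≡⟨ lemma (φ (a ∷ t)) ⟩
  0ℤ ∎
  where
  open ≡-Reasoning
  lemma : ∀ z → z -ᶻ (z -ᶻ 0ℤ) ≡ 0ℤ
  lemma = ring-ℤ
δ-normalised φ nrm (a ∷ t) (there r) =
  cong₂ _-ᶻ_ (nrm t r) (δ-normalised (λ u → φ (a ∷ u)) (λ u r′ → nrm (a ∷ u) (there r′)) t r)

module _ {q : ℕ} where

  -- K i represents the i-th power of the degree-2 generator of the cohomology of the cyclic group
  -- in its standard simplicial model; A and B witness the periodicity.
  mutual
    K : ℕ → Cochain (List (Fin (suc q)))
    K zero    []          = 0ℤ
    K zero    (_ ∷ [])    = 1ℤ
    K zero    (_ ∷ _ ∷ _) = 0ℤ
    K (suc i) t           = δ (B i) t

    B : ℕ → Cochain (List (Fin (suc q)))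
    B i []          = 0ℤ
    B i (_ ∷ [])    = 0ℤ
    B i (s ∷ u ∷ t) = [ s ≺ u ] *ᶻ K i (u ∷ t)

  A : ℕ → Cochain (List (Fin (suc q)))
  A i []      = 0ℤ
  A i (s ∷ t) = [top s ] *ᶻ K i (s ∷ t)

  K-[] : ∀ i → K i [] ≡ 0ℤ
  K-[] zero    = refl
  K-[] (suc i) = refl

  K-cocycle : ∀ i t → δ (K i) t ≡ 0ℤ
  K-cocycle (suc i) t               = δ-δ (B i) t
  K-cocycle zero    []              = refl
  K-cocycle zero    (_ ∷ [])        = refl
  K-cocycle zero    (_ ∷ _ ∷ [])    = refl
  K-cocycle zero    (_ ∷ _ ∷ _ ∷ t) = cong (λ z → 0ℤ -ᶻ (0ℤ -ᶻ (0ℤ -ᶻ z))) (δ-zero t)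

  δ-*ˡ : ∀ {V : Set} z (φ : Cochain (List V)) t → δ (λ u → z *ᶻ φ u) t ≡ z *ᶻ δ φ t
  δ-*ˡ z φ []      = sym (ℤₚ.*-zeroʳ z)
  δ-*ˡ z φ (v ∷ t) = trans (cong (z *ᶻ φ t -ᶻ_) (δ-*ˡ z (λ u → φ (v ∷ u)) t))
                           (lemma z (φ t) (δ (λ u → φ (v ∷ u)) t))
    where
    lemma : ∀ x y w → x *ᶻ y -ᶻ x *ᶻ w ≡ x *ᶻ (y -ᶻ w)
    lemma = ring-ℤ

  -- Since `K i` is closed, the faces of `s ∷ u ∷ t` that keep `s` contribute `K i (u ∷ t)` once
  -- more, so only the difference of the two `[top_]` factors survives.
  δ-A : ∀ i s u t → δ (A i) (s ∷ u ∷ t) ≡ ([top u ] -ᶻ [top s ]) *ᶻ K i (u ∷ t)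
  δ-A i s u t = begin
    [top u ] *ᶻ k -ᶻ δ (λ r → [top s ] *ᶻ K i (s ∷ r)) (u ∷ t)
      ≡⟨ cong ([top u ] *ᶻ k -ᶻ_) (δ-*ˡ [top s ] (λ r → K i (s ∷ r)) (u ∷ t)) ⟩
    [top u ] *ᶻ k -ᶻ [top s ] *ᶻ δ (λ r → K i (s ∷ r)) (u ∷ t)
      ≡⟨ cong (λ z → [top u ] *ᶻ k -ᶻ [top s ] *ᶻ z)
           (sym (ℤₚ.i-j≡0⇒i≡j k _ (K-cocycle i (s ∷ u ∷ t)))) ⟩
    [top u ] *ᶻ k -ᶻ [top s ] *ᶻ k
      ≡⟨ lemma [top u ] [top s ] k ⟩
    ([top u ] -ᶻ [top s ]) *ᶻ k ∎
    where
    open ≡-Reasoning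
    k = K i (u ∷ t)
    lemma : ∀ x y w → x *ᶻ w -ᶻ y *ᶻ w ≡ (x -ᶻ y) *ᶻ w
    lemma = ring-ℤ

  mutual
    -- By `[≺]-rot`, rotating `B i` alters it by the coboundary of `A i`, and this disappears in
    -- `K (suc i)`, the coboundary of `B i`. The two claims therefore go by a joint induction.
    K-rot : ∀ i t → K i (map rot t) ≡ K i t
    K-rot zero    []          = refl
    K-rot zero    (_ ∷ [])    = refl
    K-rot zero    (_ ∷ _ ∷ _) = refl
    K-rot (suc i) t           = begin
      δ (B i) (map rot t)                   ≡⟨ δ-map rot (B i) t ⟨
      δ (λ u → B i (map rot u)) t           ≡⟨ δ-cong (B-rot i) t ⟩
      δ (λ u → B i u -ᶻ δ (A i) u) t        ≡⟨ δ-sub (B i) (δ (A i)) t ⟩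
      δ (B i) t -ᶻ δ (δ (A i)) t            ≡⟨ cong (δ (B i) t -ᶻ_) (δ-δ (A i) t) ⟩
      δ (B i) t -ᶻ 0ℤ                       ≡⟨ ℤₚ.+-identityʳ (δ (B i) t) ⟩
      δ (B i) t                             ∎
      where open ≡-Reasoning

    B-rot : ∀ i t → B i (map rot t) ≡ B i t -ᶻ δ (A i) t
    B-rot i []          = refl
    B-rot i (_ ∷ [])    = refl
    B-rot i (s ∷ u ∷ t) = begin
      [ rot s ≺ rot u ] *ᶻ K i (map rot (u ∷ t))
        ≡⟨ cong₂ _*ᶻ_ ([≺]-rot s u) (K-rot i (u ∷ t)) ⟩
      ([ s ≺ u ] -ᶻ ([top u ] -ᶻ [top s ])) *ᶻ k
        ≡⟨ lemma [ s ≺ u ] ([top u ] -ᶻ [top s ]) k ⟩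
      [ s ≺ u ] *ᶻ k -ᶻ ([top u ] -ᶻ [top s ]) *ᶻ k
        ≡⟨ cong ([ s ≺ u ] *ᶻ k -ᶻ_) (δ-A i s u t) ⟨
      [ s ≺ u ] *ᶻ k -ᶻ δ (A i) (s ∷ u ∷ t) ∎
      where
      open ≡-Reasoning
      k = K i (u ∷ t)
      lemma : ∀ x y w → (x -ᶻ y) *ᶻ w ≡ x *ᶻ w -ᶻ y *ᶻ w
      lemma = ring-ℤ

  mutual
    K-normalised : ∀ i t → Repeats t → K i t ≡ 0ℤ
    K-normalised zero    (_ ∷ _ ∷ _) r          = refl
    K-normalised zero    (_ ∷ [])    (there ())
    K-normalised (suc i) t           r          = δ-normalised (B i) (B-normalised i) t r

    B-normalised : ∀ i t → Repeats t → B i t ≡ 0ℤ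
    B-normalised i (_ ∷ [])    r         = refl
    B-normalised i (s ∷ _ ∷ t) here      =
      trans (cong (_*ᶻ K i (s ∷ t)) ([≺]-irrefl s)) (ℤₚ.*-zeroˡ (K i (s ∷ t)))
    B-normalised i (s ∷ u ∷ t) (there r) =
      trans (cong ([ s ≺ u ] *ᶻ_) (K-normalised i (u ∷ t) r)) (ℤₚ.*-zeroʳ [ s ≺ u ])

  K-rot^ : ∀ i a t → K i ((map rot ^ a) t) ≡ K i t
  K-rot^ i zero    t = refl
  K-rot^ i (suc a) t = trans (K-rot i ((map rot ^ a) t)) (K-rot^ i a t)

  -- `K i` is invariant under rotation, and the orbit of the first label meets the top exactly once.
  norm-A : ∀ i t → Σ< (suc q) (λ a → A i ((map rot ^ a) t)) ≡ K i t
  norm-A i []      = trans (Σ<-cong (suc q) (λ a → cong (A i) (map-^-[] a)))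
                           (trans (Σ<-const (suc q) 0ℤ) (trans (ℤₚ.*-zeroʳ (+ suc q)) (sym (K-[] i))))
    where
    map-^-[] : ∀ a → (map rot ^ a) [] ≡ []
    map-^-[] zero    = refl
    map-^-[] (suc a) = cong (map rot) (map-^-[] a)
  norm-A i (s ∷ t) = begin
    Σ< (suc q) (λ a → A i ((map rot ^ a) (s ∷ t)))
      ≡⟨ Σ<-cong (suc q) (λ a → trans (cong (A i) (map-^-∷ a)) (cong ([top (rot ^ a) s ] *ᶻ_)
           (trans (cong (K i) (sym (map-^-∷ a))) (K-rot^ i a (s ∷ t))))) ⟩
    Σ< (suc q) (λ a → [top (rot ^ a) s ] *ᶻ K i (s ∷ t))
      ≡⟨ Σ<-*ʳ (suc q) (K i (s ∷ t)) (λ a → [top (rot ^ a) s ]) ⟩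
    Σ< (suc q) (λ a → [top (rot ^ a) s ]) *ᶻ K i (s ∷ t)
      ≡⟨ cong (_*ᶻ K i (s ∷ t)) (Σ-top-orbit s) ⟩
    1ℤ *ᶻ K i (s ∷ t)
      ≡⟨ ℤₚ.*-identityˡ (K i (s ∷ t)) ⟩
    K i (s ∷ t) ∎
    where
    open ≡-Reasoning
    map-^-∷ : ∀ a → (map rot ^ a) (s ∷ t) ≡ (rot ^ a) s ∷ (map rot ^ a) t
    map-^-∷ zero    = refl
    map-^-∷ (suc a) = cong (map rot) (map-^-∷ a)

-- Pairing a periodic family of chains with the classes of ℤ/p.

double : ℕ → ℕ
double zero    = zero
double (suc i) = suc (suc (double i))

parity : ∀ j → ∃ λ i → j ≡ double i ⊎ j ≡ suc (double i)
parity zero = 0 , inj₁ refl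
parity (suc j) with parity j
... | i , inj₁ refl = i , inj₂ refl
... | i , inj₂ refl = suc i , inj₁ refl

module Fan
  (q : ℕ) (2≤p : 2 ≤ suc q) {V : Set} (g : V → V)
  (X : ℕ → Cochain (List V) → Cochain ⊤)
  (X-linear : ∀ j → Linear (X j))
  (X-δ : ∀ j φ → X (suc j) (δ φ) tt ≡ X j (Resolution.D (suc q) (map g) j φ) tt)
  (X-unit : ∀ φ → (∀ v → φ (v ∷ []) ≡ 1ℤ) → X 0 φ tt ≡ 1ℤ)
  (ℓ : V → Fin (suc q)) (ℓ-equivariant : ∀ v → ℓ (g v) ≡ rot (ℓ v))
  where

  open Resolution (suc q)

  private
    p = suc q
    Ā B̄ K̄ : ℕ → Cochain (List V)
    Ā i t = A i (map ℓ t)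
    B̄ i t = B i (map ℓ t)
    K̄ i t = K i (map ℓ t)

    map-ℓ : ∀ t → map ℓ (map g t) ≡ map rot (map ℓ t)
    map-ℓ t = trans (sym (map-∘ t)) (trans (map-cong ℓ-equivariant t) (map-∘ t))

    map-ℓ^ : ∀ a t → map ℓ ((map g ^ a) t) ≡ (map rot ^ a) (map ℓ t)
    map-ℓ^ = ^-natural map-ℓ

    D-even : ∀ i φ t → D (map g) (double i) φ t ≡ D (map g) 0 φ t
    D-even zero    φ t = refl
    D-even (suc i) φ t = D-even i φ t

    D-odd : ∀ i φ t → D (map g) (suc (double i)) φ t ≡ D (map g) 1 φ t
    D-odd zero    φ t = refl
    D-odd (suc i) φ t = D-odd i φ t

    δ-^ : ∀ a φ t → δ (λ u → φ ((map g ^ a) u)) t ≡ δ φ ((map g ^ a) t)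
    δ-^ zero    φ t = refl
    δ-^ (suc a) φ t = trans (δ-^ a (λ u → φ (map g u)) t) (δ-map g φ ((map g ^ a) t))

    B̄-step : ∀ i a t → B̄ i ((map g ^ suc a) t) ≡ B̄ i ((map g ^ a) t) -ᶻ δ (λ u → Ā i ((map g ^ a) u)) t
    B̄-step i a t = begin
      B i (map ℓ (map g u))                ≡⟨ cong (B i) (map-ℓ u) ⟩
      B i (map rot (map ℓ u))              ≡⟨ B-rot i (map ℓ u) ⟩
      B̄ i u -ᶻ δ (A i) (map ℓ u)           ≡⟨ cong (B̄ i u -ᶻ_) (δ-map ℓ (A i) u) ⟨
      B̄ i u -ᶻ δ (Ā i) u                   ≡⟨ cong (B̄ i u -ᶻ_) (δ-^ a (Ā i) t) ⟨
      B̄ i u -ᶻ δ (λ u → Ā i ((map g ^ a) u)) t ∎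
      where
      open ≡-Reasoning
      u = (map g ^ a) t

    xA xB : ℕ → ℕ → ℤ
    xA i a = X (double i) (λ t → Ā i ((map g ^ a) t)) tt
    xB i a = X (suc (double i)) (λ t → B̄ i ((map g ^ a) t)) tt

    -- Passing from g^a to g^(a+1) changes `B̄ i` by a coboundary of `Ā i`. By `X-δ` the pairing
    -- turns this into a difference of two consecutive values of `xA`.
    invariant-step : ∀ i a → xB i (suc a) +ᶻ xA i (suc a) ≡ xB i a +ᶻ xA i a
    invariant-step i a = begin
      xB i (suc a) +ᶻ xA i (suc a)
        ≡⟨ cong (_+ᶻ xA i (suc a)) (≗-cong (X-linear (suc (double i))) (B̄-step i a) tt) ⟩
      X (suc (double i)) (λ t → B̄ i ((map g ^ a) t) -ᶻ δ Āᵃ t) tt +ᶻ xA i (suc a)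
        ≡⟨ cong (_+ᶻ xA i (suc a)) (sub (X-linear (suc (double i))) (λ t → B̄ i ((map g ^ a) t)) (δ Āᵃ) tt) ⟩
      xB i a -ᶻ X (suc (double i)) (δ Āᵃ) tt +ᶻ xA i (suc a)
        ≡⟨ cong (λ z → xB i a -ᶻ z +ᶻ xA i (suc a)) δ-part ⟩
      xB i a -ᶻ (xA i (suc a) -ᶻ xA i a) +ᶻ xA i (suc a)
        ≡⟨ lemma (xB i a) (xA i (suc a)) (xA i a) ⟩
      xB i a +ᶻ xA i a ∎
      where
      open ≡-Reasoning
      Āᵃ = λ t → Ā i ((map g ^ a) t)
      lemma : ∀ x y z → x -ᶻ (y -ᶻ z) +ᶻ y ≡ x +ᶻ z
      lemma = ring-ℤ
      δ-part : X (suc (double i)) (δ Āᵃ) tt ≡ xA i (suc a) -ᶻ xA i a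
      δ-part = begin
        X (suc (double i)) (δ Āᵃ) tt
          ≡⟨ X-δ (double i) Āᵃ ⟩
        X (double i) (D (map g) (double i) Āᵃ) tt
          ≡⟨ ≗-cong (X-linear (double i)) (λ t → trans (D-even i Āᵃ t)
               (cong (λ u → Ā i u -ᶻ Āᵃ t) (^-shift (map g) a t))) tt ⟩
        X (double i) (λ t → Ā i ((map g ^ suc a) t) -ᶻ Āᵃ t) tt
          ≡⟨ sub (X-linear (double i)) (λ t → Ā i ((map g ^ suc a) t)) Āᵃ tt ⟩
        xA i (suc a) -ᶻ xA i a ∎

    invariant : ∀ i a → xB i a +ᶻ xA i a ≡ xB i 0 +ᶻ xA i 0
    invariant i zero    = refl
    invariant i (suc a) = trans (invariant-step i a) (invariant i a)

    xNormB : ℕ → ℤ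
    xNormB i = X (suc (double i)) (D (map g) 1 (B̄ i)) tt

    xK : ℕ → ℤ
    xK i = X (double i) (K̄ i) tt

    -- Every summand `xB i a` is a constant minus `xA i a`. The constants add up to a multiple of p,
    -- and the `xA i a` add up to `xK i` because the norm of `A i` is `K i`.
    xNormB-xK : ∀ i → xNormB i ≡ + p *ᶻ (xB i 0 +ᶻ xA i 0) -ᶻ xK i
    xNormB-xK i = begin
      xNormB i
        ≡⟨ linear-Σ< (X-linear (suc (double i))) p (λ a t → B̄ i ((map g ^ a) t)) tt ⟩
      Σ< p (xB i)
        ≡⟨ Σ<-cong p (λ a → trans (lemma (xB i a) (xA i a)) (cong (_-ᶻ xA i a) (invariant i a))) ⟩
      Σ< p (λ a → c -ᶻ xA i a)
        ≡⟨ Σ<-sub p (λ _ → c) (xA i) ⟩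
      Σ< p (λ _ → c) -ᶻ Σ< p (xA i)
        ≡⟨ cong₂ _-ᶻ_ (Σ<-const p c) (sym (linear-Σ< (X-linear (double i)) p (λ a t → Ā i ((map g ^ a) t)) tt)) ⟩
      + p *ᶻ c -ᶻ X (double i) (λ t → Σ< p (λ a → Ā i ((map g ^ a) t))) tt
        ≡⟨ cong (+ p *ᶻ c -ᶻ_) (≗-cong (X-linear (double i)) (λ t →
             trans (Σ<-cong p (λ a → cong (A i) (map-ℓ^ a t))) (norm-A i (map ℓ t))) tt) ⟩
      + p *ᶻ c -ᶻ xK i ∎
      where
      open ≡-Reasoning
      c = xB i 0 +ᶻ xA i 0
      lemma : ∀ x y → x ≡ (x +ᶻ y) -ᶻ y
      lemma = ring-ℤ

    -- `K̄ (suc i)` is the coboundary of `B̄ i`, and the boundary of the chain in degree 2i + 2 is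
    -- the norm of the one below.
    xK-suc : ∀ i → xK (suc i) ≡ xNormB i
    xK-suc i = begin
      X (suc (suc (double i))) (K̄ (suc i)) tt
        ≡⟨ ≗-cong (X-linear (suc (suc (double i)))) (λ t → sym (δ-map ℓ (B i) t)) tt ⟩
      X (suc (suc (double i))) (δ (B̄ i)) tt
        ≡⟨ X-δ (suc (double i)) (B̄ i) ⟩
      X (suc (double i)) (D (map g) (suc (double i)) (B̄ i)) tt
        ≡⟨ ≗-cong (X-linear (suc (double i))) (D-odd i (B̄ i)) tt ⟩
      xNormB i ∎
      where open ≡-Reasoning

    IsUnitMod : ℤ → Set
    IsUnitMod z = (∃ λ c → z ≡ + p *ᶻ c +ᶻ 1ℤ) ⊎ (∃ λ c → z ≡ + p *ᶻ c -ᶻ 1ℤ)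

    negate : ∀ c {z w} → w ≡ + p *ᶻ c -ᶻ z → IsUnitMod z → IsUnitMod w
    negate c w≡ (inj₁ (d , z≡)) = inj₂ (c -ᶻ d , trans w≡ (trans (cong (+ p *ᶻ c -ᶻ_) z≡) (lemma (+ p) c d)))
      where
      lemma : ∀ x c d → x *ᶻ c -ᶻ (x *ᶻ d +ᶻ 1ℤ) ≡ x *ᶻ (c -ᶻ d) -ᶻ 1ℤ
      lemma = ring-ℤ
    negate c w≡ (inj₂ (d , z≡)) = inj₁ (c -ᶻ d , trans w≡ (trans (cong (+ p *ᶻ c -ᶻ_) z≡) (lemma (+ p) c d)))
      where
      lemma : ∀ x c d → x *ᶻ c -ᶻ (x *ᶻ d -ᶻ 1ℤ) ≡ x *ᶻ (c -ᶻ d) +ᶻ 1ℤ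
      lemma = ring-ℤ

    p∤1 : ∀ c z → ∣ z ∣ᶻ ≡ 1 → ¬ (+ p *ᶻ c ≡ z)
    p∤1 c z ∣z∣≡1 eq = ℕₚ.<⇒≢ 2≤p (sym (ℕₚ.m*n≡1⇒m≡1 p ∣ c ∣ᶻ
      (trans (sym (ℤₚ.abs-* (+ p) c)) (trans (cong ∣_∣ᶻ eq) ∣z∣≡1))))

    unit≢0 : ∀ {z} → IsUnitMod z → ¬ (z ≡ 0ℤ)
    unit≢0 (inj₁ (c , z≡)) z≡0 = p∤1 c (- 1ℤ) refl (lemma (+ p *ᶻ c) (trans (sym z≡) z≡0))
      where
      lemma : ∀ x → x +ᶻ 1ℤ ≡ 0ℤ → x ≡ - 1ℤ
      lemma x eq = ℤₚ.i-j≡0⇒i≡j x (- 1ℤ) eq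
    unit≢0 (inj₂ (c , z≡)) z≡0 = p∤1 c 1ℤ refl (ℤₚ.i-j≡0⇒i≡j (+ p *ᶻ c) 1ℤ (trans (sym z≡) z≡0))

    mutual
      -- The value is 1 on a point, and going up two degrees changes its sign modulo p.
      xK-unit : ∀ i → IsUnitMod (xK i)
      xK-unit zero    = inj₁ (0ℤ , trans (X-unit (K̄ 0) (λ _ → refl)) (cong (_+ᶻ 1ℤ) (sym (ℤₚ.*-zeroʳ (+ p)))))
      xK-unit (suc i) = subst IsUnitMod (sym (xK-suc i)) (xNormB-unit i)

      xNormB-unit : ∀ i → IsUnitMod (xNormB i)
      xNormB-unit i = negate (xB i 0 +ᶻ xA i 0) (xNormB-xK i) (xK-unit i)

  -- In every degree, X is supported on some tuple whose consecutive labels differ.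
  fan : ∀ j → ¬ (∀ φ → (∀ t → Repeats (map ℓ t) → φ t ≡ 0ℤ) → X j φ tt ≡ 0ℤ)
  fan j vanishes with parity j
  -- Even degrees are detected by `K̄ i`. Odd degrees are detected by the norm of `B̄ i`, whose
  -- summands are normalised because rotation preserves repetitions.
  ... | i , inj₁ refl = unit≢0 (xK-unit i) (vanishes (K̄ i) λ t → K-normalised i (map ℓ t))
  ... | i , inj₂ refl = unit≢0 (xNormB-unit i) (vanishes (D (map g) 1 (B̄ i)) normB-zero)
    where
    rot^-repeats : ∀ a {t} → Repeats t → Repeats ((map rot ^ a) t)
    rot^-repeats zero    r = r
    rot^-repeats (suc a) r = Repeats-map rot (rot^-repeats a r)

    normB-zero : ∀ t → Repeats (map ℓ t) → D (map g) 1 (B̄ i) t ≡ 0ℤ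
    normB-zero t r =
      trans (Σ<-cong p (λ a → B-normalised i _ (subst Repeats (sym (map-ℓ^ a t)) (rot^-repeats a r))))
            (trans (Σ<-const p 0ℤ) (ℤₚ.*-zeroʳ (+ p)))

-- The position and the sign of a nonzero entry; equivalently a vertex of an iterated join of ℤ/p.
Point : ℕ → Set
Point p = ℕ × Fin p

turn : ∀ {q} → Point (suc q) → Point (suc q)
turn = map₂ rot

-- A periodic family of chains in the iterated join of ℤ/p.

module Join (q : ℕ) where

  open Resolution (suc q)

  map-^ : ∀ {A : Set} (f : A → A) a t → (map f ^ a) t ≡ map (f ^ a) t
  map-^ f zero    t = sym (map-id t)
  map-^ f (suc a) t = trans (cong (map f) (map-^ f a t)) (sym (map-∘ t))

  turn-order : ∀ t → (map (turn {q}) ^ suc q) t ≡ t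
  turn-order t = trans (map-^ turn (suc q) t) (trans (map-cong turn^p≡id t) (map-id t))
    where
    turn^ : ∀ a (v : Point (suc q)) → (turn ^ a) v ≡ (proj₁ v , (rot ^ a) (proj₂ v))
    turn^ zero    v = refl
    turn^ (suc a) v = cong turn (turn^ a v)

    turn^p≡id : ∀ v → (turn ^ suc q) v ≡ v
    turn^p≡id v = trans (turn^ (suc q) v) (cong (proj₁ v ,_) (rot^p≡id (proj₂ v)))

  -- Integration over a j-chain x_j of the join with ∂ x_(j+1) = D_j x_j, obtained by coning
  -- D_j x_j with a point of the (j+1)-st factor.
  x : ℕ → Cochain (List (Point (suc q))) → Cochain ⊤
  x zero    φ _ = φ ((0 , zero) ∷ [])
  x (suc j) φ _ = x j (D (map turn) j (λ t → φ ((suc j , zero) ∷ t))) tt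

  x-linear : ∀ j → Linear (x j)
  x-linear zero    = precompose-linear _
  x-linear (suc j) = record { ≗-cong = ≗-cong L ; sub = sub L }
    where L = ∘-linear (x-linear j) (∘-linear (D-linear (map turn) j) (precompose-linear ((suc j , zero) ∷_)))

  D-δ : ∀ j φ t → D (map turn) j (δ φ) t ≡ δ (D (map (turn {q})) j φ) t
  D-δ j φ t = sym (D-natural δ-linear (δ-map turn) j φ t)

  -- The boundary of a cone is its base minus the cone over the boundary of the base. The base D_j
  -- x_j is a cycle: by the case below, its boundary is a composite of two consecutive
  -- differentials.
  x-δ : ∀ j φ → x (suc j) (δ φ) tt ≡ x j (D (map turn) j φ) tt
  x-δ j φ = begin
    x j (D (map turn) j (λ t → φ t -ᶻ δ ψ t)) tt
      ≡⟨ sub (∘-linear (x-linear j) (D-linear (map turn) j)) φ (δ ψ) tt ⟩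
    x j (D (map turn) j φ) tt -ᶻ x j (D (map turn) j (δ ψ)) tt
      ≡⟨ cong (x j (D (map turn) j φ) tt -ᶻ_) (vanish j ψ) ⟩
    x j (D (map turn) j φ) tt -ᶻ 0ℤ
      ≡⟨ ℤₚ.+-identityʳ _ ⟩
    x j (D (map turn) j φ) tt ∎
    where
    open ≡-Reasoning
    ψ = λ t → φ ((suc j , zero) ∷ t)
    vanish : ∀ j ψ → x j (D (map turn) j (δ ψ)) tt ≡ 0ℤ
    -- The boundary of a point is the empty tuple, which `turn` fixes, so g - 1 kills it.
    vanish zero    ψ = trans (D-δ 0 ψ ((0 , zero) ∷ [])) (cong (_-ᶻ 0ℤ) (ℤₚ.+-inverseʳ (ψ [])))
    vanish (suc j) ψ = begin
      x (suc j) (D (map turn) (suc j) (δ ψ)) tt            ≡⟨ ≗-cong (x-linear (suc j)) (D-δ (suc j) ψ) tt ⟩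
      x (suc j) (δ (D (map turn) (suc j) ψ)) tt            ≡⟨ x-δ j (D (map turn) (suc j) ψ) ⟩
      x j (D (map turn) j (D (map turn) (suc j) ψ)) tt     ≡⟨ zero-pres (x-linear j) (D-D (map turn) turn-order j ψ) tt ⟩
      0ℤ                                                   ∎

  Facet : ℕ → List (Point (suc q)) → Set
  Facet n t = map proj₁ t ≡ downFrom n

  Facet-turn : ∀ {n} t → Facet n t → Facet n (map turn t)
  Facet-turn t eq = trans (sym (map-∘ t)) eq

  -- Coning adds a point at the new position and the group moves only signs, so the tuples entering
  -- x_j have positions j, ..., 0, once each.
  x-local-zero : ∀ j φ → (∀ t → Facet (suc j) t → φ t ≡ 0ℤ) → x j φ tt ≡ 0ℤ
  x-local-zero zero    φ z = z _ refl
  x-local-zero (suc j) φ z = x-local-zero j _ λ t facet → D-zero j _ facet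
    (λ t facet → z _ (cong (suc j ∷_) facet))
    where
    D-zero : ∀ i (ψ : Cochain (List (Point (suc q)))) {n t} → Facet n t →
             (∀ t → Facet n t → ψ t ≡ 0ℤ) → D (map turn) i ψ t ≡ 0ℤ
    D-zero zero          ψ {t = t} facet z = cong₂ _-ᶻ_ (z (map turn t) (Facet-turn t facet)) (z t facet)
    D-zero (suc zero)    ψ {n} {t} facet z =
      trans (Σ<-cong (suc q) (λ a → z _ (facet^ a)))
            (trans (Σ<-const (suc q) 0ℤ) (ℤₚ.*-zeroʳ (+ suc q)))
      where
      facet^ : ∀ a → Facet n ((map turn ^ a) t)
      facet^ zero    = facet
      facet^ (suc a) = Facet-turn ((map turn ^ a) t) (facet^ a)
    D-zero (suc (suc i)) ψ facet z = D-zero i ψ facet z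

  private
    Chain : Set
    Chain = List⁺ (List⁺ (Point (suc q)))

    turn² : Chain → Chain
    turn² = List⁺.map (List⁺.map turn)

    sd² : ℕ → Cochain (List Chain) → Cochain (List (Point (suc q)))
    sd² d φ = sd d (sd d φ)

    sd²-linear : ∀ d → Linear (sd² d)
    sd²-linear d = ∘-linear (sd-linear d) (sd-linear d)

    sd²-δ : ∀ d φ t → sd² (suc d) (δ φ) t ≡ δ (sd² d φ) t
    sd²-δ d φ t = trans (≗-cong (sd-linear (suc d)) (sd-δ d φ) t) (sd-δ d (sd d φ) t)

    sd²-turn : ∀ d φ t → sd² d (λ u → φ (map turn² u)) t ≡ sd² d φ (map turn t)
    sd²-turn d φ t = trans (≗-cong (sd-linear d) (sd-map (List⁺.map turn) d φ) t) (sd-map turn d (sd d φ) t)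

    X : ℕ → Cochain (List Chain) → Cochain ⊤
    X j φ = x j (sd² (suc j) φ)

    X-linear : ∀ j → Linear (X j)
    X-linear j = ∘-linear (x-linear j) (sd²-linear (suc j))

    X-δ : ∀ j φ → X (suc j) (δ φ) tt ≡ X j (D (map turn²) j φ) tt
    X-δ j φ = begin
      x (suc j) (sd² (suc (suc j)) (δ φ)) tt        ≡⟨ ≗-cong (x-linear (suc j)) (sd²-δ (suc j) φ) tt ⟩
      x (suc j) (δ (sd² (suc j) φ)) tt              ≡⟨ x-δ j (sd² (suc j) φ) ⟩
      x j (D (map turn) j (sd² (suc j) φ)) tt       ≡⟨ ≗-cong (x-linear j) (λ t → sym (D-sd² t)) tt ⟩
      x j (sd² (suc j) (D (map turn²) j φ)) tt      ∎
      where
      open ≡-Reasoning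
      D-sd² = D-natural (sd²-linear (suc j)) (sd²-turn (suc j)) j φ

    X-unit : ∀ φ → (∀ v → φ (v ∷ []) ≡ 1ℤ) → X 0 φ tt ≡ 1ℤ
    -- Each of the two subdivisions of a point leaves one trivial `0ℤ` term of the coboundary.
    X-unit φ unit = cong (λ z → z -ᶻ 0ℤ -ᶻ 0ℤ) (unit _)

  -- `Fan.fan` applied to the twice subdivided chains. A cochain killed by repetitions would vanish
  -- on all flags, and locality would carry this through both subdivisions and the facets to a zero
  -- pairing.
  alternating-flag :
    2 ≤ suc q → (ℓ : Chain → Fin (suc q)) → (∀ C → ℓ (turn² C) ≡ rot (ℓ C)) →
    ∀ N → ¬ (∀ t s u → Facet (suc N) t → Flag t s → length u ≡ suc N → Flag s u → Repeats (map ℓ u))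
  alternating-flag 2≤p ℓ ℓ-equivariant N repeats =
    Fan.fan q 2≤p turn² X X-linear X-δ X-unit ℓ ℓ-equivariant N λ φ φ-zero →
      x-local-zero N (sd² (suc N) φ) λ t facet →
      sd-local-zero (suc N) (sd (suc N) φ) t λ s _ flag →
      sd-local-zero (suc N) φ s λ u len flag′ →
      φ-zero u (repeats t s u facet flag len flag′)

-- Finite sums and counting.

bit : Bool → ℕ
bit b = if b then 1 else 0

sum-mono-≤ : ∀ {n} {f g : Fin n → ℕ} → (∀ i → f i ≤ g i) → sum f ≤ sum g
sum-mono-≤ {zero}  le = z≤n
sum-mono-≤ {suc n} le = ℕₚ.+-mono-≤ (le zero) (sum-mono-≤ (λ i → le (suc i)))

sum-const : ∀ n c → sum {n} (λ _ → c) ≡ n * c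
sum-const zero    c = refl
sum-const (suc n) c = cong (_+_ c) (sum-const n c)

sum-*ʳ : ∀ {n} (f : Fin n → ℕ) c → sum (λ i → f i * c) ≡ sum f * c
sum-*ʳ {zero}  f c = refl
sum-*ʳ {suc n} f c = trans (cong (_+_ (f zero * c)) (sum-*ʳ (λ i → f (suc i)) c)) (sym (ℕₚ.*-distribʳ-+ c (f zero) _))

≤-sum : ∀ {n} (f : Fin n → ℕ) i → f i ≤ sum f
≤-sum f zero    = ℕₚ.m≤m+n _ _
≤-sum f (suc i) = ℕₚ.≤-trans (≤-sum (λ j → f (suc j)) i) (ℕₚ.m≤n+m _ _)

bit≤1 : ∀ b → bit b ≤ 1
bit≤1 true  = ℕₚ.≤-refl
bit≤1 false = z≤n

count : ∀ {n} → (Fin n → Bool) → ℕ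
count b = sum (λ i → bit (b i))

count-cong : ∀ {n} {b c : Fin n → Bool} → b ≗ c → count b ≡ count c
count-cong eq = sum-cong-≗ (λ i → cong bit (eq i))

count≤n : ∀ {n} (b : Fin n → Bool) → count b ≤ n
count≤n {n} b = ℕₚ.≤-trans (sum-mono-≤ (λ i → bit≤1 (b i))) (ℕₚ.≤-reflexive (trans (sum-const n 1) (ℕₚ.*-identityʳ n)))

count-true : ∀ {n} (b : Fin n → Bool) i → b i ≡ true → 1 ≤ count b
count-true b i eq = ℕₚ.≤-trans (ℕₚ.≤-reflexive (sym (cong bit eq))) (≤-sum (λ j → bit (b j)) i)

count-false : ∀ {n} (b : Fin n → Bool) i → b i ≡ false → count b < n
count-false {suc n} b zero    eq rewrite eq = s≤s (count≤n (λ j → b (suc j)))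
count-false {suc n} b (suc i) eq =
  ℕₚ.+-mono-≤-< (bit≤1 (b zero)) (count-false (λ j → b (suc j)) i eq)

count≤1 : ∀ {n} (b : Fin n → Bool) → (∀ i j → b i ≡ true → b j ≡ true → i ≡ j) → count b ≤ 1
count≤1 {zero}  b unique = z≤n
count≤1 {suc n} b unique with b zero in eq
... | true  = s≤s (ℕₚ.≤-reflexive (trans (sum-cong-≗ others) (trans (sum-const n 0) (ℕₚ.*-zeroʳ n))))
  where
  others : ∀ j → bit (b (suc j)) ≡ 0
  others j with b (suc j) in eq′
  ... | false = refl
  ... | true  = contradiction (unique zero (suc j) eq eq′) λ ()
... | false = count≤1 (λ j → b (suc j)) λ i j bi bj → Finₚ.suc-injective (unique (suc i) (suc j) bi bj)

count-mono : ∀ {n} {b c : Fin n → Bool} → (∀ i → b i ≡ true → c i ≡ true) →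
             count b < count c ⊎ b ≗ c
count-mono {zero}          le = inj₂ λ ()
count-mono {suc n} {b} {c} le with count-mono {n} (λ i → le (suc i)) | b zero in eqb | c zero in eqc
... | inj₁ lt | true  | true  = inj₁ (s≤s lt)
... | inj₁ lt | false | false = inj₁ lt
... | inj₁ lt | false | true  = inj₁ (ℕₚ.m<n⇒m<1+n lt)
... | inj₂ eq | false | true  = inj₁ (s≤s (ℕₚ.≤-reflexive (count-cong eq)))
... | inj₂ eq | true  | true  = inj₂ λ { zero → trans eqb (sym eqc) ; (suc i) → eq i }
... | inj₂ eq | false | false = inj₂ λ { zero → trans eqb (sym eqc) ; (suc i) → eq i }
... | _       | true  | false = contradiction (trans (sym (le zero eqb)) eqc) λ ()

sum-rot : ∀ {q} (f : Fin (suc q) → ℕ) → sum f ≡ sum (λ i → f (rot i))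
sum-rot {q} f = sum-permute f (permutation rot (rot ^ q) rot^p≡id (λ i → trans (^-shift rot q i) (rot^p≡id i)))

-- Means of subsets of ℤ/p and an equivariant choice of label.

toℕ-mod : ∀ q a → toℕ (a mod suc q) ≡ a % suc q
toℕ-mod q a = Finₚ.toℕ-fromℕ< (m%n<n a (suc q))

-- Modulo p the sum `S′` is `S + N`, and `u` is an inverse of `N`, so the quotient by `N` grows by
-- one.
shift-% : ∀ q u S S′ N t → S′ + t * suc q ≡ S + N → (u * N) % suc q ≡ 1 % suc q →
          (u * S′) % suc q ≡ suc ((u * S) % suc q) % suc q
shift-% q u S S′ N t total-eq unit = begin
  (u * S′) % p                       ≡⟨ [m+kn]%n≡m%n (u * S′) (u * t) p ⟨
  (u * S′ + u * t * p) % p           ≡⟨ cong (_% p) (trans (factor u S′ t p) (cong (u *_) total-eq)) ⟩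
  (u * (S + N)) % p                  ≡⟨ cong (_% p) (trans (ℕₚ.*-distribˡ-+ u S N) (ℕₚ.+-comm (u * S) (u * N))) ⟩
  (u * N + u * S) % p                ≡⟨ %-distribˡ-+ (u * N) (u * S) p ⟩
  ((u * N) % p + (u * S) % p) % p    ≡⟨ cong (λ z → (z + (u * S) % p) % p) unit ⟩
  (1 % p + (u * S) % p) % p          ≡⟨ cong (λ z → (1 % p + z) % p) (m%n%n≡m%n (u * S) p) ⟨
  (1 % p + (u * S) % p % p) % p      ≡⟨ %-distribˡ-+ 1 ((u * S) % p) p ⟨
  suc ((u * S) % p) % p              ∎
  where
  open ≡-Reasoning
  p = suc q
  factor : ∀ x y z w → x * y + x * z * w ≡ x * (y + z * w)
  factor = ring-ℕ

module Mean (q : ℕ) (prime : Prime (suc q)) where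

  private p = suc q

  total : (Fin p → Bool) → ℕ
  total b = sum (λ i → bit (b i) * toℕ i)

  abstract

    inverse : ∀ N → ∃ λ u → 0 < N → N < p → (u * N) % p ≡ 1 % p
    inverse N with 0 <? N | N <? p
    ... | no N≤0  | _       = 0 , λ 0<N → contradiction 0<N N≤0
    ... | yes _   | no N≥p  = 0 , λ _ N<p → contradiction N<p N≥p
    ... | yes 0<N | yes N<p with coprime-Bézout (prime⇒coprime prime {{>-nonZero 0<N}} N<p)
    ...   | Bézout.-+ x y eq = y , λ _ _ → trans (cong (_% p) (sym eq)) ([m+kn]%n≡m%n 1 x p)
    -- Here `y * N` is -1 modulo p, so the inverse is -y, represented by `q * y` as q is -1 modulo
    -- p.
    ...   | Bézout.+- x y eq = q * y , λ _ _ → (begin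
      (q * y * N) % p                 ≡⟨ [m+kn]%n≡m%n (q * y * N) x p ⟨
      (q * y * N + x * p) % p         ≡⟨ cong (λ z → (q * y * N + z) % p) eq ⟨
      (q * y * N + (1 + y * N)) % p   ≡⟨ cong (_% p) (lemma q y N) ⟩
      (1 + y * N * p) % p             ≡⟨ [m+kn]%n≡m%n 1 (y * N) p ⟩
      1 % p                           ∎)
      where
      open ≡-Reasoning
      lemma : ∀ q y N → q * y * N + (1 + y * N) ≡ 1 + y * N * (1 + q)
      lemma = ring-ℕ

    -- The sum of the elements divided in ℤ/p by their number. The division is meaningful for a
    -- nonempty proper subset because p is prime.
    mean : (Fin p → Bool) → Fin p
    mean b = (proj₁ (inverse (count b)) * total b) mod p

    toℕ-mean : ∀ b → toℕ (mean b) ≡ (proj₁ (inverse (count b)) * total b) % p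
    toℕ-mean b = toℕ-mod q (proj₁ (inverse (count b)) * total b)

    mean-cong : ∀ {b c} → b ≗ c → mean b ≡ mean c
    mean-cong {b} {c} eq = cong₂ (λ N S → (proj₁ (inverse N) * S) mod p) (count-cong eq)
                                 (sum-cong-≗ (λ i → cong (λ z → bit z * toℕ i) (eq i)))

  module _ {b b′ : Fin p → Bool} (shifted : ∀ i → b′ (rot i) ≡ b i) where

    count-rot : count b′ ≡ count b
    count-rot = trans (sum-rot (λ i → bit (b′ i))) (count-cong shifted)

    private
      top : Fin p → ℕ
      top i = bit (does (toℕ i ≟ q))

      toℕ-rot-ℕ : ∀ i → toℕ (rot i) + top i * p ≡ toℕ i + 1
      toℕ-rot-ℕ i with rotView i
      ... | wraps i≡ ri rewrite dec-true (toℕ i ≟ q) i≡ =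
        trans (cong₂ _+_ ri (ℕₚ.*-identityˡ p)) (trans (cong suc (sym i≡)) (ℕₚ.+-comm 1 (toℕ i)))
      ... | steps i< ri rewrite dec-false (toℕ i ≟ q) (ℕₚ.<⇒≢ i<) =
        trans (ℕₚ.+-identityʳ _) (trans ri (ℕₚ.+-comm 1 (toℕ i)))

      -- The number of elements of `b` that pass from q to 0; each lowers the sum by p relative to a
      -- unit shift.
      wrapped = sum (λ i → bit (b i) * top i)

    total-rot : total b′ + wrapped * p ≡ total b + count b
    total-rot = begin
      total b′ + wrapped * p
        ≡⟨ cong₂ _+_ (sum-rot (λ i → bit (b′ i) * toℕ i)) (sym (sum-*ʳ (λ i → bit (b i) * top i) p)) ⟩
      sum (λ i → bit (b′ (rot i)) * toℕ (rot i)) + sum (λ i → bit (b i) * top i * p)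
        ≡⟨ ∑-distrib-+ (λ i → bit (b′ (rot i)) * toℕ (rot i)) (λ i → bit (b i) * top i * p) ⟨
      sum (λ i → bit (b′ (rot i)) * toℕ (rot i) + bit (b i) * top i * p)
        ≡⟨ sum-cong-≗ (λ i → trans (cong (λ z → bit z * toℕ (rot i) + bit (b i) * top i * p) (shifted i))
             (trans (factor (bit (b i)) (toℕ (rot i)) (top i) p)
             (trans (cong (bit (b i) *_) (toℕ-rot-ℕ i)) (expand (bit (b i)) (toℕ i))))) ⟩
      sum (λ i → bit (b i) * toℕ i + bit (b i))
        ≡⟨ ∑-distrib-+ (λ i → bit (b i) * toℕ i) (λ i → bit (b i)) ⟩
      total b + count b ∎
      where
      open ≡-Reasoning
      factor : ∀ x y z w → x * y + x * z * w ≡ x * (y + z * w)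
      factor = ring-ℕ
      expand : ∀ x y → x * (y + 1) ≡ x * y + x
      expand = ring-ℕ

    mean-rot : 0 < count b → count b < p → mean b′ ≡ rot (mean b)
    mean-rot 0<N N<p = Finₚ.toℕ-injective (begin
      toℕ (mean b′)                                  ≡⟨ toℕ-mean b′ ⟩
      (proj₁ (inverse (count b′)) * total b′) % p    ≡⟨ cong (λ N → (proj₁ (inverse N) * total b′) % p) count-rot ⟩
      (u * total b′) % p                             ≡⟨ shift-% q u (total b) (total b′) (count b) wrapped total-rot unit ⟩
      suc ((u * total b) % p) % p                    ≡⟨ cong (λ z → suc z % p) (toℕ-mean b) ⟨
      suc (toℕ (mean b)) % p                         ≡⟨ toℕ-rot (mean b) ⟨
      toℕ (rot (mean b))                             ∎)
      where
      open ≡-Reasoning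
      u = proj₁ (inverse (count b))
      unit = proj₂ (inverse (count b)) 0<N N<p

  -- A label chosen equivariantly from a family of subsets of ℤ/p: the mean of the last
  -- non-empty member.  The mean of all of ℤ/p is useless, hence the default value.
  select : ∀ {N} → Dec (N ≡ 0) → Dec (N < p) → Fin p → Fin p → Fin p → Fin p
  select (yes _) _       m rest default = rest
  select (no _)  (yes _) m rest default = m
  select (no _)  (no _)  m rest default = default

  pick : ℕ → (ℕ → Fin p → Bool) → Fin p → Fin p
  pick zero    A default = default
  pick (suc L) A default = select (count (A L) ≟ 0) (count (A L) <? p) (mean (A L)) (pick L A default) default

  select-rot : ∀ {N} (e : Dec (N ≡ 0)) (l : Dec (N < p)) {m m′ r r′ d} →
               (0 < N → N < p → m′ ≡ rot m) → r′ ≡ rot r →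
               select e l m′ r′ (rot d) ≡ rot (select e l m r d)
  select-rot (yes _)  _         m≡ r≡ = r≡
  select-rot (no N≢0) (yes N<p) m≡ r≡ = m≡ (ℕₚ.n≢0⇒n>0 N≢0) N<p
  select-rot (no _)   (no _)    m≡ r≡ = refl

  select-cong : ∀ {N} (e : Dec (N ≡ 0)) (l : Dec (N < p)) {m m′ r r′ d d′} →
                m ≡ m′ → N < p → (N ≡ 0 → r ≡ r′) → select e l m r d ≡ select e l m′ r′ d′
  select-cong (yes N≡0) _        m≡ N<p r≡ = r≡ N≡0
  select-cong (no _)    (yes _)  m≡ N<p r≡ = m≡
  select-cong (no _)    (no N≮p) m≡ N<p r≡ = contradiction N<p N≮p

  pick-rot : ∀ L {A A′} → (∀ v i → A′ v (rot i) ≡ A v i) → ∀ d → pick L A′ (rot d) ≡ rot (pick L A d)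
  pick-rot zero    shifted d = refl
  pick-rot (suc L) {A} {A′} shifted d =
    trans (cong (λ N → select (N ≟ 0) (N <? p) (mean (A′ L)) (pick L A′ (rot d)) (rot d)) (count-rot {A L} {A′ L} (shifted L)))
          (select-rot (count (A L) ≟ 0) (count (A L) <? p) (mean-rot {A L} {A′ L} (shifted L)) (pick-rot L shifted d))

  -- The default is reached only if all members are empty or the last nonempty one is all of ℤ/p.
  -- Both are excluded, so the label depends on the family alone.
  pick-cong : ∀ L {A A′} → (∀ v → v < L → A v ≗ A′ v) → (∀ v → v < L → count (A v) < p) →
              (∃ λ v → v < L × 0 < count (A v)) → ∀ d d′ → pick L A d ≡ pick L A′ d′
  pick-cong (suc L) {A} {A′} eq proper (v , v<L , 0<N) d d′ =
    trans (select-cong (count (A L) ≟ 0) (count (A L) <? p) (mean-cong (eq L ℕₚ.≤-refl)) (proper L ℕₚ.≤-refl) rest)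
          (cong (λ N → select (N ≟ 0) (N <? p) (mean (A′ L)) (pick L A′ d′) d′) (count-cong (eq L ℕₚ.≤-refl)))
    where
    rest : count (A L) ≡ 0 → pick L A d ≡ pick L A′ d′
    rest N≡0 = pick-cong L (λ w w<L → eq w (ℕₚ.m<n⇒m<1+n w<L)) (λ w w<L → proper w (ℕₚ.m<n⇒m<1+n w<L))
                 (v , ℕₚ.≤∧≢⇒< (ℕₚ.≤-pred v<L) (λ { refl → ℕₚ.<⇒≢ 0<N (sym N≡0) }) , 0<N) d d′

-- The rank of a family of subsets of ℤ/p.

rank : ∀ {p} → ℕ → (ℕ → Fin p → Bool) → ℕ
rank zero    A = 0
rank (suc L) A = rank L A + count (A L)

rank-mono : ∀ {p} L {A A′ : ℕ → Fin p → Bool} → (∀ v i → A v i ≡ true → A′ v i ≡ true) →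
            rank L A < rank L A′ ⊎ (∀ v → v < L → A v ≗ A′ v)
rank-mono zero    le = inj₂ λ _ ()
rank-mono (suc L) le with rank-mono L le | count-mono (le L)
... | inj₁ lt | inj₁ lt′ = inj₁ (ℕₚ.+-mono-< lt lt′)
... | inj₁ lt | inj₂ eq  = inj₁ (ℕₚ.+-mono-<-≤ lt (ℕₚ.≤-reflexive (count-cong eq)))
... | inj₂ eq | inj₁ lt  = inj₁ (ℕₚ.+-mono-≤-< (ℕₚ.≤-reflexive (rank-cong L eq)) lt)
  where
  rank-cong : ∀ L {A A′} → (∀ v → v < L → A v ≗ A′ v) → rank L A ≡ rank L A′
  rank-cong zero    eq = refl
  rank-cong (suc L) eq = cong₂ _+_ (rank-cong L (λ v v<L → eq v (ℕₚ.m<n⇒m<1+n v<L))) (count-cong (eq L ℕₚ.≤-refl))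
... | inj₂ eq | inj₂ eq′ = inj₂ λ v v<1+L → [ eq v , (λ { refl → eq′ }) ]′ (ℕₚ.m<1+n⇒m<n∨m≡n v<1+L)

0<rank : ∀ {p} L (A : ℕ → Fin p → Bool) {v} → v < L → 0 < count (A v) → 0 < rank L A
0<rank (suc L) A {v} v<1+L 0<N with ℕₚ.m<1+n⇒m<n∨m≡n v<1+L
... | inj₁ v<L  = ℕₚ.≤-trans (0<rank L A v<L 0<N) (ℕₚ.m≤m+n _ _)
... | inj₂ refl = ℕₚ.≤-trans 0<N (ℕₚ.m≤n+m _ _)

rank≤ : ∀ {p} α m {c} (A : ℕ → Fin p → Bool) → (∀ v → v < α → count (A v) ≤ 1) →
        (∀ v → α ≤ v → count (A v) ≤ c) → rank (m + α) A ≤ m * c + α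
rank≤ α (suc m) {c} A low high = begin
  rank (m + α) A + count (A (m + α))   ≤⟨ ℕₚ.+-mono-≤ (rank≤ α m A low high) (high (m + α) (ℕₚ.m≤n+m α m)) ⟩
  m * c + α + c                        ≡⟨ ℕₚ.+-comm (m * c + α) c ⟩
  c + (m * c + α)                      ≡⟨ ℕₚ.+-assoc c (m * c) α ⟨
  c + m * c + α                        ∎
  where open ℕₚ.≤-Reasoning
rank≤ α zero A low high = rank≤α α low
  where
  rank≤α : ∀ α → (∀ v → v < α → count (A v) ≤ 1) → rank α A ≤ α
  rank≤α zero    low = z≤n
  rank≤α (suc α) low =
    ℕₚ.≤-trans (ℕₚ.+-mono-≤ (rank≤α α (λ v v<α → low v (ℕₚ.m<n⇒m<1+n v<α))) (low α ℕₚ.≤-refl))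
               (ℕₚ.≤-reflexive (ℕₚ.+-comm α 1))

-- Subsets of prescribed size.

∣tabulate∣ : ∀ {n} (b : Fin n → Bool) → ∣ tabulate b ∣ ≡ count b
∣tabulate∣ {zero}  b = refl
∣tabulate∣ {suc n} b with b zero
... | true  = cong suc (∣tabulate∣ (λ i → b (suc i)))
... | false = ∣tabulate∣ (λ i → b (suc i))

∈-tabulate⁺ : ∀ {n} (b : Fin n → Bool) {i} → b i ≡ true → i ∈ₛ tabulate b
∈-tabulate⁺ b {i} eq = lookup⇒[]= i (tabulate b) (trans (lookup∘tabulate b i) eq)

∈-tabulate⁻ : ∀ {n} (b : Fin n → Bool) {i} → i ∈ₛ tabulate b → b i ≡ true
∈-tabulate⁻ b {i} i∈ = trans (sym (lookup∘tabulate b i)) ([]=⇒lookup i∈)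

∣∩∣+∣∩∁∣ : ∀ {n} (F U : Subset n) → ∣ F ∩ U ∣ + ∣ F ∩ ∁ U ∣ ≡ ∣ F ∣
∣∩∣+∣∩∁∣ []            []            = refl
∣∩∣+∣∩∁∣ (outside ∷ F) (_       ∷ U) = ∣∩∣+∣∩∁∣ F U
∣∩∣+∣∩∁∣ (inside  ∷ F) (inside  ∷ U) = cong suc (∣∩∣+∣∩∁∣ F U)
∣∩∣+∣∩∁∣ (inside  ∷ F) (outside ∷ U) = trans (ℕₚ.+-suc _ _) (cong suc (∣∩∣+∣∩∁∣ F U))

-- The overlap lies in the part of `F` outside `U`, which has at most s elements.
overlap≤ : ∀ {n} s {F F′ U : Subset n} → ∣ F ∣ ≤ s + ∣ F ∩ U ∣ → (∀ {a} → a ∈ₛ F′ → a ∉ₛ U) → ∣ F ∩ F′ ∣ ≤ s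
overlap≤ s {F} {F′} {U} big avoids = ℕₚ.≤-trans
  (p⊆q⇒∣p∣≤∣q∣ λ a∈ → x∈p∩q⁺ (proj₁ (x∈p∩q⁻ F F′ a∈) , x∉p⇒x∈∁p (avoids (proj₂ (x∈p∩q⁻ F F′ a∈)))))
  (ℕₚ.+-cancelˡ-≤ ∣ F ∩ U ∣ _ _ (ℕₚ.≤-trans (ℕₚ.≤-reflexive (∣∩∣+∣∩∁∣ F U))
    (ℕₚ.≤-trans big (ℕₚ.≤-reflexive (ℕₚ.+-comm s ∣ F ∩ U ∣)))))

-- Kept apart from its specification so that the set depends on `k`, `U` and `W` alone and not on
-- proofs. Optional elements are skipped while the rest of `W` is large enough.
between : ∀ {n} → ℕ → Subset n → Subset n → Subset n
between k []            []            = []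
between k (inside  ∷ U) (_       ∷ W) = inside ∷ between (k ∸ 1) U W
between k (outside ∷ U) (outside ∷ W) = outside ∷ between k U W
between k (outside ∷ U) (inside  ∷ W) with k ≤? ∣ W ∣
... | yes _ = outside ∷ between k U W
... | no _  = inside ∷ between (k ∸ 1) U W

record Between {n} (k : ℕ) (U W F : Subset n) : Set where
  constructor mkBetween
  field
    size  : ∣ F ∣ ≡ k
    lower : U ⊆ₛ F
    upper : F ⊆ₛ W

∷-⊆ : ∀ {n} b {c} {p q : Subset n} → (b ≡ inside → c ≡ inside) → p ⊆ₛ q → (b ∷ p) ⊆ₛ (c ∷ q)
∷-⊆ inside  b⇒c p⊆q here with refl ← b⇒c refl = here
∷-⊆ b       b⇒c p⊆q (there a∈p) = there (p⊆q a∈p)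

between-spec : ∀ {n} k (U W : Subset n) → U ⊆ₛ W → ∣ U ∣ ≤ k → k ≤ ∣ W ∣ → Between k U W (between k U W)
between-spec zero    []            []            _   _   _   = mkBetween refl (λ ()) (λ ())
between-spec k       (inside ∷ U)  (outside ∷ W) U⊆W _   _   = contradiction (U⊆W here) λ ()
between-spec (suc k) (inside ∷ U)  (inside ∷ W)  U⊆W (s≤s U≤k) (s≤s k≤W) =
  let mkBetween size lower upper = between-spec k U W (drop-∷-⊆ U⊆W) U≤k k≤W
  in  mkBetween (cong suc size) (∷-⊆ inside (λ _ → refl) lower) (∷-⊆ inside (λ _ → refl) upper)
between-spec k       (outside ∷ U) (outside ∷ W) U⊆W U≤k k≤W =
  let mkBetween size lower upper = between-spec k U W (drop-∷-⊆ U⊆W) U≤k k≤W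
  in  mkBetween size (∷-⊆ outside (λ ()) lower) (∷-⊆ outside (λ ()) upper)
between-spec k       (outside ∷ U) (inside ∷ W)  U⊆W U≤k k≤W with k ≤? ∣ W ∣
... | yes k≤W′ =
  let mkBetween size lower upper = between-spec k U W (drop-∷-⊆ U⊆W) U≤k k≤W′
  in  mkBetween size (∷-⊆ outside (λ ()) lower) (∷-⊆ outside (λ ()) upper)
between-spec zero    (outside ∷ U) (inside ∷ W)  U⊆W U≤k k≤W | no k≰W = contradiction z≤n k≰W
between-spec (suc k) (outside ∷ U) (inside ∷ W)  U⊆W U≤k (s≤s k≤W) | no k≰W =
  let U≤W = p⊆q⇒∣p∣≤∣q∣ (drop-∷-⊆ U⊆W)
      W≤k = ℕₚ.≤-pred (ℕₚ.≰⇒> k≰W)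
      mkBetween size lower upper = between-spec k U W (drop-∷-⊆ U⊆W) (ℕₚ.≤-trans U≤W W≤k) k≤W
  in  mkBetween (cong suc size) (∷-⊆ outside (λ ()) lower) (∷-⊆ inside (λ _ → refl) upper)

fill : ∀ {n} → ℕ → Subset n → Subset n → Subset n
fill k U W with ∣ U ∣ ≤? k
... | yes _ = between k U W
... | no _  = between k ∅ U

-- If `U` has at most k elements then `F` contains it, otherwise `F` lies inside it. Either way at
-- most s elements of `F` fall outside `U`.
fill-spec : ∀ {n} k s {U W : Subset n} → U ⊆ₛ W → k ≤ ∣ W ∣ → k ≤ s + ∣ U ∣ →
            let F = fill k U W in ∣ F ∣ ≡ k × F ⊆ₛ W × k ≤ s + ∣ F ∩ U ∣
fill-spec {n} k s {U} {W} U⊆W k≤W k≤s+U with ∣ U ∣ ≤? k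
... | yes U≤k =
  let mkBetween size lower upper = between-spec k U W U⊆W U≤k k≤W
  in  size , upper , ℕₚ.≤-trans k≤s+U (ℕₚ.+-monoʳ-≤ s (p⊆q⇒∣p∣≤∣q∣ λ a∈U → x∈p∩q⁺ (lower a∈U , a∈U)))
... | no U≰k =
  let ∅≤k = ℕₚ.≤-trans (ℕₚ.≤-reflexive (∣⊥∣≡0 n)) z≤n
      mkBetween size lower upper = between-spec k ∅ U ⊥⊆ ∅≤k (ℕₚ.<⇒≤ (ℕₚ.≰⇒> U≰k))
  in  size , (λ a∈F → U⊆W (upper a∈F)) ,
      ℕₚ.≤-trans (ℕₚ.≤-reflexive (sym size)) (ℕₚ.≤-trans
        (p⊆q⇒∣p∣≤∣q∣ (λ a∈F → x∈p∩q⁺ (a∈F , upper a∈F))) (ℕₚ.m≤n+m _ s))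

-- Partial functions from positions to ℤ/p, listed by their graphs

look : ∀ {p} → List (Point p) → ℕ → Maybe (Fin p)
look []            a = nothing
look ((b , z) ∷ X) a = if does (a ≟ b) then just z else look X a

look-turn : ∀ {q} (X : List (Point (suc q))) a → look (map turn X) a ≡ Maybe.map rot (look X a)
look-turn []            a = refl
look-turn ((b , z) ∷ X) a with does (a ≟ b)
... | true  = refl
... | false = look-turn X a

equals fits : ∀ {p} → Fin p → Maybe (Fin p) → Bool
equals z nothing  = false
equals z (just y) = does (y Finₚ.≟ z)
fits   z nothing  = true
fits   z (just y) = does (y Finₚ.≟ z)

isNothing : ∀ {A : Set} → Maybe A → Bool
isNothing nothing  = true
isNothing (just _) = false

does-rot : ∀ {q} (y z : Fin (suc q)) → does (rot y Finₚ.≟ rot z) ≡ does (y Finₚ.≟ z)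
does-rot y z with y Finₚ.≟ z
... | yes y≡z = dec-true (rot y Finₚ.≟ rot z) (cong rot y≡z)
... | no y≢z  = dec-false (rot y Finₚ.≟ rot z) (λ eq → y≢z (rot-injective eq))

equals-rot : ∀ {q} (z : Fin (suc q)) m → equals (rot z) (Maybe.map rot m) ≡ equals z m
equals-rot z nothing  = refl
equals-rot z (just y) = does-rot y z

fits-rot : ∀ {q} (z : Fin (suc q)) m → fits (rot z) (Maybe.map rot m) ≡ fits z m
fits-rot z nothing  = refl
fits-rot z (just y) = does-rot y z

equals-true : ∀ {p} {z : Fin p} m → equals z m ≡ true → m ≡ just z
equals-true {z = z} (just y) eq with y Finₚ.≟ z
... | yes y≡z = cong just y≡z

fits-true : ∀ {p} {z y : Fin p} → fits z (just y) ≡ true → y ≡ z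
fits-true {z = z} {y} eq with y Finₚ.≟ z
... | yes y≡z = y≡z

fits-bit : ∀ {p} (z : Fin p) m → bit (fits z m) ≡ bit (isNothing m) + bit (equals z m)
fits-bit z nothing  = refl
fits-bit z (just y) = refl

sum-δ : ∀ {n} (y : Fin n) → sum (λ z → bit (does (y Finₚ.≟ z))) ≡ 1
sum-δ {n} y = ℕₚ.≤-antisym
  (count≤1 (λ z → does (y Finₚ.≟ z)) λ i j yi yj → trans (sym (from i yi)) (from j yj))
  (count-true (λ z → does (y Finₚ.≟ z)) y (dec-true (y Finₚ.≟ y) refl))
  where
  from : ∀ z → does (y Finₚ.≟ z) ≡ true → y ≡ z
  from z eq with y Finₚ.≟ z
  ... | yes y≡z = y≡z

class-sum : ∀ {p} (m : Maybe (Fin p)) → bit (isNothing m) + sum (λ z → bit (equals z m)) ≡ 1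
class-sum {p} nothing = cong suc (trans (sum-const p 0) (ℕₚ.*-zeroʳ p))
class-sum     (just y) = sum-δ y

module Classes (n : ℕ) {q : ℕ} where

  private p = suc q

  -- In the notation of sign vectors, class X z is X_z and room X z is the union of X_z with
  -- the set of zeros of X.
  class room : List (Point p) → Fin p → Subset n
  class X z = tabulate (λ a → equals z (look X (toℕ a)))
  room  X z = tabulate (λ a → fits z (look X (toℕ a)))

  free : List (Point p) → ℕ
  free X = sum {n} (λ a → bit (isNothing (look X (toℕ a))))

  class-turn : ∀ X z → class (map turn X) (rot z) ≡ class X z
  class-turn X z = tabulate-cong λ a →
    trans (cong (equals (rot z)) (look-turn X (toℕ a))) (equals-rot z (look X (toℕ a)))

  room-turn : ∀ X z → room (map turn X) (rot z) ≡ room X z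
  room-turn X z = tabulate-cong λ a →
    trans (cong (fits (rot z)) (look-turn X (toℕ a))) (fits-rot z (look X (toℕ a)))

  free-turn : ∀ X → free (map turn X) ≡ free X
  free-turn X = sum-cong-≗ {n} λ a → cong bit
    (trans (cong isNothing (look-turn X (toℕ a))) (isNothing-map (look X (toℕ a))))
    where
    isNothing-map : ∀ (m : Maybe (Fin p)) → isNothing (Maybe.map rot m) ≡ isNothing m
    isNothing-map nothing  = refl
    isNothing-map (just _) = refl

  class⊆room : ∀ X z → class X z ⊆ₛ room X z
  class⊆room X z a∈ = ∈-tabulate⁺ (λ a → fits z (look X (toℕ a)))
    (equals⇒fits (look X _) (∈-tabulate⁻ (λ a → equals z (look X (toℕ a))) a∈))
    where
    equals⇒fits : ∀ m → equals z m ≡ true → fits z m ≡ true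
    equals⇒fits (just _) eq = eq

  ∣room∣ : ∀ X z → ∣ room X z ∣ ≡ free X + ∣ class X z ∣
  ∣room∣ X z = begin
    ∣ room X z ∣
      ≡⟨ ∣tabulate∣ {n} (λ a → fits z (look X (toℕ a))) ⟩
    sum {n} (λ a → bit (fits z (look X (toℕ a))))
      ≡⟨ sum-cong-≗ {n} (λ a → fits-bit z (look X (toℕ a))) ⟩
    sum {n} (λ a → bit (isNothing (look X (toℕ a))) + bit (equals z (look X (toℕ a))))
      ≡⟨ ∑-distrib-+ {n} (λ a → bit (isNothing (look X (toℕ a)))) (λ a → bit (equals z (look X (toℕ a)))) ⟩
    free X + sum {n} (λ a → bit (equals z (look X (toℕ a))))
      ≡⟨ cong (_+_ (free X)) (∣tabulate∣ {n} (λ a → equals z (look X (toℕ a)))) ⟨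
    free X + ∣ class X z ∣ ∎
    where open ≡-Reasoning

  ∑∣class∣ : ∀ X → free X + sum (λ z → ∣ class X z ∣) ≡ n
  ∑∣class∣ X = begin
    free X + sum (λ z → ∣ class X z ∣)
      ≡⟨ cong (_+_ (free X)) (sum-cong-≗ (λ z → ∣tabulate∣ {n} (λ a → equals z (look X (toℕ a))))) ⟩
    free X + sum (λ z → sum {n} (λ a → bit (equals z (look X (toℕ a)))))
      ≡⟨ cong (_+_ (free X)) (∑-comm {p} {n} (λ z a → bit (equals z (look X (toℕ a))))) ⟩
    free X + sum {n} (λ a → sum (λ z → bit (equals z (look X (toℕ a)))))
      ≡⟨ ∑-distrib-+ {n} (λ a → bit (isNothing (look X (toℕ a))))
                         (λ a → sum (λ z → bit (equals z (look X (toℕ a))))) ⟨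
    sum {n} (λ a → bit (isNothing (look X (toℕ a))) + sum (λ z → bit (equals z (look X (toℕ a)))))
      ≡⟨ sum-cong-≗ {n} (λ a → class-sum (look X (toℕ a))) ⟩
    sum {n} (λ _ → 1)
      ≡⟨ trans (sum-const n 1) (ℕₚ.*-identityʳ n) ⟩
    n ∎
    where open ≡-Reasoning

  Distinct : List (Point p) → Set
  Distinct X = AllPairs (λ u v → proj₁ u ≢ proj₁ v) X × All (λ u → proj₁ u < n) X

  look-absent : ∀ (X : List (Point p)) {a} → All (λ v → a ≢ proj₁ v) X → look X a ≡ nothing
  look-absent []            []         = refl
  look-absent ((b , z) ∷ X) {a} (a≢b ∷ a∉) rewrite dec-false (a ≟ b) a≢b = look-absent X a∉

  length+free : ∀ X → Distinct X → length X + free X ≡ n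
  length+free []            _ = trans (sum-const n 1) (ℕₚ.*-identityʳ n)
  length+free ((b , z) ∷ X) (b∉ ∷ distinct , b<n ∷ bounded) =
    trans (trans (sym (ℕₚ.+-suc (length X) (free ((b , z) ∷ X)))) (cong (_+_ (length X)) free-∷))
          (length+free X (distinct , bounded))
    where
    open ≡-Reasoning
    at : Fin n → Bool
    at a = does (fromℕ< b<n Finₚ.≟ a)

    step : ∀ a → bit (at a) + bit (isNothing (look ((b , z) ∷ X) (toℕ a))) ≡ bit (isNothing (look X (toℕ a)))
    step a with fromℕ< b<n Finₚ.≟ a
    ... | yes refl rewrite dec-true (toℕ (fromℕ< b<n) ≟ b) (Finₚ.toℕ-fromℕ< b<n) =
      cong (λ m → bit (isNothing m))
           (sym (look-absent X (subst (λ c → All (λ v → c ≢ proj₁ v) X) (sym (Finₚ.toℕ-fromℕ< b<n)) b∉)))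
    ... | no b≢a
      rewrite dec-false (toℕ a ≟ b) (λ a≡b → b≢a (Finₚ.toℕ-injective (trans (Finₚ.toℕ-fromℕ< b<n) (sym a≡b)))) = refl

    free-∷ : suc (free ((b , z) ∷ X)) ≡ free X
    free-∷ = begin
      1 + free ((b , z) ∷ X)
        ≡⟨ cong (_+ free ((b , z) ∷ X)) (sum-δ (fromℕ< b<n)) ⟨
      sum (λ a → bit (at a)) + free ((b , z) ∷ X)
        ≡⟨ ∑-distrib-+ {n} (λ a → bit (at a)) (λ a → bit (isNothing (look ((b , z) ∷ X) (toℕ a)))) ⟨
      sum (λ a → bit (at a) + bit (isNothing (look ((b , z) ∷ X) (toℕ a))))
        ≡⟨ sum-cong-≗ step ⟩
      free X ∎

  -- `look` returns the first entry at a position, so distinct positions in `Y` ensure that no added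
  -- point hides one of `X`.
  look-mono : ∀ {X Y : List (Point p)} → X ⊆ Y → AllPairs (λ u v → proj₁ u ≢ proj₁ v) Y →
              ∀ a {z} → look X a ≡ just z → look Y a ≡ just z
  look-mono (refl ∷ X⊆Y) (_ ∷ distinct) a {z} eq with look-mono X⊆Y distinct a {z}
  look-mono {(b , _) ∷ _} (refl ∷ X⊆Y) (_ ∷ distinct) a {z} eq | rec with does (a ≟ b)
  ... | true  = eq
  ... | false = rec eq
  look-mono {X} {(b , y) ∷ Y} (_ ∷ʳ X⊆Y) (b∉ ∷ distinct) a {z} eq with a ≟ b
  ... | no a≢b rewrite dec-false (a ≟ b) a≢b = look-mono X⊆Y distinct a eq
  ... | yes refl = contradiction (trans (sym (look-mono X⊆Y distinct a eq)) (look-absent Y b∉)) λ ()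

  -- At a position of X_z the larger `Y` still has sign z, which is neither zero nor `z′`.
  room-avoids-class : ∀ {X Y} → X ⊆ Y → Distinct Y → ∀ {z z′} → z ≢ z′ →
                      ∀ {a} → a ∈ₛ room Y z′ → a ∉ₛ class X z
  room-avoids-class {X} {Y} X⊆Y (distinct , _) {z} {z′} z≢z′ {a} a∈room a∈class =
    z≢z′ (fits-true (trans (cong (fits z′) (sym Ya≡z)) (∈-tabulate⁻ (λ a → fits z′ (look Y (toℕ a))) a∈room)))
    where
    Xa≡z : look X (toℕ a) ≡ just z
    Xa≡z = equals-true (look X (toℕ a)) (∈-tabulate⁻ (λ a → equals z (look X (toℕ a))) a∈class)
    Ya≡z : look Y (toℕ a) ≡ just z
    Ya≡z = look-mono X⊆Y distinct (toℕ a) Xa≡z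

  look-just : ∀ (X : List (Point p)) a {z} → look X a ≡ just z → Any (λ v → proj₂ v ≡ z) X
  look-just ((b , y) ∷ X) a eq with does (a ≟ b)
  look-just ((b , y) ∷ X) a refl | true = here refl
  ... | false = there (look-just X a eq)

  class-occurs : ∀ X z → 0 < ∣ class X z ∣ → Any (λ v → proj₂ v ≡ z) X
  class-occurs X z 0<N with Finₚ.any? (λ a → equals z (look X (toℕ a)) ≟ᵇ true)
  ... | yes (a , eq) = look-just X (toℕ a) (equals-true (look X (toℕ a)) eq)
  ... | no none = contradiction 0<N (ℕₚ.≤⇒≯ (ℕₚ.≤-reflexive (begin
    ∣ class X z ∣                                      ≡⟨ ∣tabulate∣ {n} (λ a → equals z (look X (toℕ a))) ⟩
    sum {n} (λ a → bit (equals z (look X (toℕ a))))    ≡⟨ sum-cong-≗ {n} (λ a → cong bit (¬-not λ eq → none (a , eq))) ⟩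
    sum {n} (λ _ → 0)                                  ≡⟨ trans (sum-const n 0) (ℕₚ.*-zeroʳ n) ⟩
    0                                                  ∎)))
    where open ≡-Reasoning

AllPairs-resp-⊆ : ∀ {A : Set} {R : A → A → Set} {xs ys : List A} → xs ⊆ ys → AllPairs R ys → AllPairs R xs
AllPairs-resp-⊆ []           []       = []
AllPairs-resp-⊆ (_ ∷ʳ xs⊆ys) (_ ∷ rs) = AllPairs-resp-⊆ xs⊆ys rs
AllPairs-resp-⊆ (refl ∷ xs⊆ys) (r ∷ rs) = All-resp-⊆ xs⊆ys r ∷ AllPairs-resp-⊆ xs⊆ys rs

⊆-length-≡ : ∀ {A : Set} {xs ys : List A} → xs ⊆ ys → length xs ≡ length ys → xs ≡ ys
⊆-length-≡ xs⊆ys eq = ≋⇒≡ (toPointwise eq xs⊆ys)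

-- The maximum is one of its two terms. If every class stays below `k ∸ s`, then the sum is at most
-- p (k - s - 1). If every class stays below `k ∸ f`, then n is at most p f + p (k - 1 - f) = p (k -
-- 1), against the lower bound on n.
threshold-met : ∀ {q} (k n s f : ℕ) (N : Fin (suc q) → ℕ) → suc q * (k ∸ 1) + 1 ≤ n → f + sum N ≡ n →
                suc q * (k ∸ s ∸ 1) < sum N → ∃ λ z → (k ∸ s) ⊔ (k ∸ f) ≤ N z
threshold-met {q} k n s f N n-large total sum-large
  with Finₚ.any? (λ z → (k ∸ s) ⊔ (k ∸ f) ≤? N z)
... | yes found = found
... | no none with ℕₚ.⊔-sel (k ∸ s) (k ∸ f)
...   | inj₁ eq = contradiction sum-large (ℕₚ.≤⇒≯ (ℕₚ.≤-trans
          (sum-mono-≤ (λ z → ℕₚ.∸-monoˡ-≤ 1 (subst (N z <_) eq (ℕₚ.≰⇒> λ le → none (z , le)))))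
          (ℕₚ.≤-reflexive (sum-const (suc q) (k ∸ s ∸ 1)))))
...   | inj₂ eq = contradiction n-large (ℕₚ.<⇒≱ (begin-strict
          n                            ≡⟨ total ⟨
          f + sum N                    ≤⟨ ℕₚ.+-mono-≤ (ℕₚ.m≤m+n f (q * f)) (sum-mono-≤ below′) ⟩
          p * f + sum {p} (λ _ → k ∸ 1 ∸ f) ≡⟨ cong (_+_ (p * f)) (sum-const p (k ∸ 1 ∸ f)) ⟩
          p * f + p * (k ∸ 1 ∸ f)      ≡⟨ ℕₚ.*-distribˡ-+ p f (k ∸ 1 ∸ f) ⟨
          p * (f + (k ∸ 1 ∸ f))        ≡⟨ cong (p *_) (ℕₚ.m+[n∸m]≡n f≤k-1) ⟩
          p * (k ∸ 1)                  <⟨ ℕₚ.n<1+n _ ⟩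
          suc (p * (k ∸ 1))            ≡⟨ ℕₚ.+-comm 1 (p * (k ∸ 1)) ⟩
          p * (k ∸ 1) + 1              ∎))
  where
  open ℕₚ.≤-Reasoning
  p = suc q
  below : ∀ z → N z < k ∸ f
  below z = subst (N z <_) eq (ℕₚ.≰⇒> λ le → none (z , le))

  below′ : ∀ z → N z ≤ k ∸ 1 ∸ f
  below′ z = ℕₚ.≤-trans (ℕₚ.∸-monoˡ-≤ 1 (below z)) (ℕₚ.≤-reflexive (begin-equality
    k ∸ f ∸ 1     ≡⟨ ℕₚ.∸-+-assoc k f 1 ⟩
    k ∸ (f + 1)   ≡⟨ cong (k ∸_) (ℕₚ.+-comm f 1) ⟩
    k ∸ (1 + f)   ≡⟨ ℕₚ.∸-+-assoc k 1 f ⟨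
    k ∸ 1 ∸ f     ∎))

  f≤k-1 : f ≤ k ∸ 1
  f≤k-1 = ℕₚ.∸-monoˡ-≤ 1 (ℕₚ.m∸n≢0⇒n<m (ℕₚ.m<n⇒n≢0 (below zero)))

-- The search follows the order of the list, which `turn` preserves; the order of `Fin p` would not
-- give an equivariant choice.
firstSat : ∀ {p} → (Fin p → Bool) → List (Point p) → Fin p → Fin p
firstSat P []            default = default
firstSat P ((_ , z) ∷ X) default = if P z then z else firstSat P X default

firstSat-turn : ∀ {q} {P P′ : Fin (suc q) → Bool} → (∀ z → P′ (rot z) ≡ P z) → ∀ X d →
                firstSat P′ (map turn X) (rot d) ≡ rot (firstSat P X d)
firstSat-turn         P′≡P []            d = refl
firstSat-turn {P = P} P′≡P ((_ , z) ∷ X) d rewrite P′≡P z with P z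
... | true  = refl
... | false = firstSat-turn P′≡P X d

firstSat-true : ∀ {p} (P : Fin p → Bool) X d {z} → Any (λ v → proj₂ v ≡ z) X → P z ≡ true →
                P (firstSat P X d) ≡ true
firstSat-true P ((_ , y) ∷ X) d occ Pz with P y in Py
... | true = Py
firstSat-true P ((_ , y) ∷ X) d (here refl) Pz | false = contradiction (trans (sym Pz) Py) λ ()
firstSat-true P ((_ , y) ∷ X) d (there occ) Pz | false = firstSat-true P X d occ Pz

does-sound : ∀ {A : Set} (a? : Dec A) → does a? ≡ true → A
does-sound (yes a) _ = a

match : ∀ {p} → Fin p × ℕ → ℕ → Fin p → Bool
match (y , w) v z = does (y Finₚ.≟ z) ∧ does (w ≟ v)

match-refl : ∀ {p} (l : Fin p × ℕ) → match l (proj₂ l) (proj₁ l) ≡ true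
match-refl (y , w) = cong₂ _∧_ (dec-true (y Finₚ.≟ y) refl) (dec-true (w ≟ w) refl)

match-sound : ∀ {p} (l : Fin p × ℕ) v z → match l v z ≡ true → l ≡ (z , v)
match-sound (y , w) v z eq with y Finₚ.≟ z
... | yes refl = cong (y ,_) (does-sound (w ≟ v) eq)

small-overlap⇒IsEdge : ∀ {n k s r} → s < k → (X : Fin r → Vertex n k) →
  (∀ i j → i ≢ j → ∣ proj₁ (X i) ∩ proj₁ (X j) ∣ ≤ s) → IsEdge n k s r X
small-overlap⇒IsEdge {k = k} {s} s<k X small i j i≢j = distinct , small i j i≢j
  where
  distinct : ¬ (proj₁ (X i) ≡ proj₁ (X j))
  distinct eq = ℕₚ.<⇒≱ s<k (begin
    k                                  ≡⟨ proj₂ (X i) ⟨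
    ∣ proj₁ (X i) ∣                    ≡⟨ cong ∣_∣ (∩-idem (proj₁ (X i))) ⟨
    ∣ proj₁ (X i) ∩ proj₁ (X i) ∣      ≡⟨ cong (λ G → ∣ proj₁ (X i) ∩ G ∣) eq ⟩
    ∣ proj₁ (X i) ∩ proj₁ (X j) ∣      ≤⟨ small i j i≢j ⟩
    s                                  ∎)
    where open ℕₚ.≤-Reasoning

-- Labels of faces and chains for prime r.

module PrimeCase
  (q : ℕ) (prime : Prime (suc q)) (k n s m : ℕ) (n-large : suc q * (k ∸ 1) + 1 ≤ n) (s<k : s < k)
  (c : Vertex n k → Fin m) (proper : ProperColoring n k s (suc q) m c)
  where

  open Classes n {q}
  open Mean q prime
  open Join q using (Facet; alternating-flag)

  private
    p α : ℕ
    p = suc q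
    α = p * (k ∸ s ∸ 1)

    2≤p : 2 ≤ p
    2≤p = nonTrivial⇒n>1 p {{prime⇒nonTrivial prime}}

    Face : Set
    Face = List⁺ (Point p)

  -- With `k ∸ s` elements a class can hold all but s elements of a k-set; with `k ∸ free X`
  -- elements its room contains a k-set.
  threshold : List (Point p) → ℕ
  threshold X = (k ∸ s) ⊔ (k ∸ free X)

  large : List (Point p) → Fin p → Bool
  large X z = does (threshold X ≤? ∣ class X z ∣)

  sign : Face → Fin p
  sign X = proj₂ (List⁺.head X)

  chosen : Face → Fin p
  chosen X = firstSat (large (toList X)) (toList X) (sign X)

  vertex : Face → Fin p → Subset n
  vertex X z = fill k (class (toList X) z) (room (toList X) z)

  -- Colouring bare subsets keeps size proofs out of the labels. The value 0 at other sizes is a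
  -- placeholder.
  color : Subset n → ℕ
  color F with ∣ F ∣ ≟ k
  ... | yes eq = toℕ (c (F , eq))
  ... | no _   = 0

  abstract

    -- Faces with at most α points are labelled by their size, as in Sarkaria's inequality.
    label : Face → Fin p × ℕ
    label X = if does (length (toList X) ≤? α)
              then (sign X , length (List⁺.tail X))
              else (chosen X , α + color (vertex X (chosen X)))

    label-small : ∀ {X} → length (toList X) ≤ α → label X ≡ (sign X , length (List⁺.tail X))
    label-small {X} le rewrite dec-true (length (toList X) ≤? α) le = refl

    label-large : ∀ {X} → α < length (toList X) → label X ≡ (chosen X , α + color (vertex X (chosen X)))
    label-large {X} lt rewrite dec-false (length (toList X) ≤? α) (ℕₚ.<⇒≱ lt) = refl

  chosen-turn : ∀ X → chosen (List⁺.map turn X) ≡ rot (chosen X)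
  chosen-turn X = firstSat-turn
    (λ z → cong₂ (λ f C → does ((k ∸ s) ⊔ (k ∸ f) ≤? ∣ C ∣)) (free-turn (toList X)) (class-turn (toList X) z))
    (toList X) (sign X)

  label-turn : ∀ X → label (List⁺.map turn X) ≡ (rot (proj₁ (label X)) , proj₂ (label X))
  label-turn X with length (toList X) ≤? α
  ... | yes le = trans (label-small {List⁺.map turn X} (subst (_≤ α) (sym (length-map turn (toList X))) le))
                       (trans (cong (rot (sign X) ,_) (length-map turn (List⁺.tail X)))
                              (cong (λ l → rot (proj₁ l) , proj₂ l) (sym (label-small {X} le))))
  ... | no ¬le = trans (label-large {List⁺.map turn X} (subst (α <_) (sym (length-map turn (toList X))) (ℕₚ.≰⇒> ¬le)))
                       (trans (cong₂ (λ z F → z , α + color F) (chosen-turn X) vertex-turn)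
                              (cong (λ l → rot (proj₁ l) , proj₂ l) (sym (label-large {X} (ℕₚ.≰⇒> ¬le)))))
    where
    vertex-turn : vertex (List⁺.map turn X) (chosen (List⁺.map turn X)) ≡ vertex X (chosen X)
    vertex-turn = trans (cong (vertex (List⁺.map turn X)) (chosen-turn X))
      (cong₂ (fill k) (class-turn (toList X) (chosen X)) (room-turn (toList X) (chosen X)))

  color-vertex : ∀ F (eq : ∣ F ∣ ≡ k) → color F ≡ toℕ (c (F , eq))
  color-vertex F eq with ∣ F ∣ ≟ k
  ... | yes eq′ = cong (λ e → toℕ (c (F , e))) (ℕₚ.≡-irrelevant eq′ eq)
  ... | no neq  = contradiction eq neq

  module _ {X : Face} (distinct : Distinct (toList X)) (big : α < length (toList X)) where

    private
      xs = toList X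
      z = chosen X

    chosen-large : threshold xs ≤ ∣ class xs z ∣
    chosen-large =
      let total = ∑∣class∣ xs
          sum≡length = ℕₚ.+-cancelˡ-≡ (free xs) _ _
            (trans total (trans (sym (length+free xs distinct)) (ℕₚ.+-comm (length xs) (free xs))))
          y , y-large = threshold-met k n s (free xs) (λ z → ∣ class xs z ∣) n-large total
            (subst (α <_) (sym sum≡length) big)
          -- As `k ∸ s` is positive, `y` is the sign of some point of the face, so `firstSat`
          -- succeeds.
          occurs = class-occurs xs y
            (ℕₚ.≤-trans (ℕₚ.m<n⇒0<n∸m s<k) (ℕₚ.≤-trans (ℕₚ.m≤m⊔n (k ∸ s) (k ∸ free xs)) y-large))
      in  does-sound (threshold xs ≤? ∣ class xs z ∣)
            (firstSat-true (large xs) xs (sign X) occurs (dec-true (threshold xs ≤? ∣ class xs y ∣) y-large))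

    vertex-spec : ∣ vertex X z ∣ ≡ k × vertex X z ⊆ₛ room xs z × k ≤ s + ∣ vertex X z ∩ class xs z ∣
    vertex-spec = fill-spec k s (class⊆room xs z)
      (ℕₚ.≤-trans (ℕₚ.m≤n+m∸n k (free xs)) (ℕₚ.≤-trans
        (ℕₚ.+-monoʳ-≤ (free xs) (ℕₚ.≤-trans (ℕₚ.m≤n⊔m (k ∸ s) (k ∸ free xs)) chosen-large))
        (ℕₚ.≤-reflexive (sym (∣room∣ xs z)))))
      (ℕₚ.≤-trans (ℕₚ.m≤n+m∸n k s) (ℕₚ.+-monoʳ-≤ s (ℕₚ.≤-trans (ℕₚ.m≤m⊔n (k ∸ s) (k ∸ free xs)) chosen-large)))

  -- Sizes counted from 0 fill the values below α, and the m colours fill the next m.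
  label<L : ∀ {X} → Distinct (toList X) → proj₂ (label X) < m + α
  label<L {X} distinct with ℕₚ.≤-<-connex (length (toList X)) α
  ... | inj₁ le = subst (_< m + α) (sym (cong proj₂ (label-small {X} le))) (ℕₚ.≤-trans le (ℕₚ.m≤n+m α m))
  ... | inj₂ lt = subst (_< m + α) (sym (cong proj₂ (label-large {X} lt)))
    (ℕₚ.<-≤-trans (ℕₚ.+-monoʳ-< α color<m) (ℕₚ.≤-reflexive (ℕₚ.+-comm α m)))
    where
    size = proj₁ (vertex-spec {X} distinct lt)
    color<m : color (vertex X (chosen X)) < m
    color<m = subst (_< m) (sym (color-vertex (vertex X (chosen X)) size)) (Finₚ.toℕ<n (c (vertex X (chosen X) , size)))

  -- For each value v this is the set of signs paired with v along a chain, the family on which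
  -- `pick` and `rank` operate.
  occurs : List Face → ℕ → Fin p → Bool
  occurs []      v z = false
  occurs (X ∷ C) v z = match (label X) v z ∨ occurs C v z

  occurs-turn : ∀ C v z → occurs (map (List⁺.map turn) C) v (rot z) ≡ occurs C v z
  occurs-turn []      v z = refl
  occurs-turn (X ∷ C) v z = cong₂ _∨_
    (trans (cong (λ l → match l v (rot z)) (label-turn X))
           (cong (_∧ does (proj₂ (label X) ≟ v)) (does-rot (proj₁ (label X)) z)))
    (occurs-turn C v z)

  occurs⁺ : ∀ {C X} → X ∈ C → occurs C (proj₂ (label X)) (proj₁ (label X)) ≡ true
  occurs⁺ {X ∷ C} (here refl) = cong (_∨ occurs C (proj₂ (label X)) (proj₁ (label X))) (match-refl (label X))
  occurs⁺ {Y ∷ C} {X} (there X∈C) =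
    trans (cong (match (label Y) (proj₂ (label X)) (proj₁ (label X)) ∨_) (occurs⁺ X∈C)) (∨-zeroʳ _)

  occurs⁻ : ∀ C {v z} → occurs C v z ≡ true → ∃ λ X → X ∈ C × label X ≡ (z , v)
  occurs⁻ (X ∷ C) {v} {z} eq with match (label X) v z in eq′
  ... | true  = X , here refl , match-sound (label X) v z eq′
  ... | false = let Y , Y∈C , eq″ = occurs⁻ C eq in Y , there Y∈C , eq″

  occurs-mono : ∀ {C C′} → C′ ⊆ C → ∀ v z → occurs C′ v z ≡ true → occurs C v z ≡ true
  occurs-mono {C} {C′} C′⊆C v z eq with occurs⁻ C′ eq
  ... | X , X∈C′ , refl = occurs⁺ (⊆-lookup C′⊆C X∈C′)

  record IsChain (C : List Face) : Set where
    field
      distinct   : ∀ {X} → X ∈ C → Distinct (toList X)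
      comparable : ∀ {X Y} → X ∈ C → Y ∈ C → toList X ⊆ toList Y ⊎ toList Y ⊆ toList X

  open IsChain

  IsChain-resp-⊆ : ∀ {C C′} → C′ ⊆ C → IsChain C → IsChain C′
  IsChain-resp-⊆ C′⊆C chain = record
    { distinct   = λ X∈ → distinct chain (⊆-lookup C′⊆C X∈)
    ; comparable = λ X∈ Y∈ → comparable chain (⊆-lookup C′⊆C X∈) (⊆-lookup C′⊆C Y∈)
    }

  toList-injective : ∀ {X Y : Face} → toList X ≡ toList Y → X ≡ Y
  toList-injective refl = refl

  -- A value below α records the size of a face, and comparable faces of equal size coincide.
  small-labels : ∀ {C} → IsChain C → ∀ v → v < α → count (occurs C v) ≤ 1
  small-labels {C} chain v v<α = count≤1 (occurs C v) unique
    where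
    length≡ : ∀ {X z} → label X ≡ (z , v) → length (toList X) ≡ suc v
    length≡ {X} eq with length (toList X) ≤? α
    ... | yes le = cong suc (cong proj₂ (trans (sym (label-small {X} le)) eq))
    ... | no ¬le = contradiction v<α (ℕₚ.≤⇒≯ (ℕₚ.≤-trans (ℕₚ.m≤m+n α _)
                     (ℕₚ.≤-reflexive (cong proj₂ (trans (sym (label-large {X} (ℕₚ.≰⇒> ¬le))) eq)))))

    unique : ∀ y z → occurs C v y ≡ true → occurs C v z ≡ true → y ≡ z
    unique y z oy oz with occurs⁻ C oy | occurs⁻ C oz
    ... | X , X∈ , X≡ | Y , Y∈ , Y≡ = cong proj₁ (trans (sym X≡) (trans (cong label X≡Y) Y≡))
      where
      len : length (toList X) ≡ length (toList Y)
      len = trans (length≡ {X} X≡) (sym (length≡ {Y} Y≡))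
      X≡Y : X ≡ Y
      X≡Y with comparable chain X∈ Y∈
      ... | inj₁ X⊆Y = toList-injective (⊆-length-≡ X⊆Y len)
      ... | inj₂ Y⊆X = toList-injective (sym (⊆-length-≡ Y⊆X (sym len)))

  -- If all p signs shared one colour, the chosen k-sets would form a monochromatic edge: for faces
  -- X_i ⊆ X_j the set of X_j avoids the class i of X_i, which holds all but s elements of the set
  -- of X_i.
  large-labels : ∀ {C} → IsChain C → ∀ v → α ≤ v → count (occurs C v) ≤ q
  large-labels {C} chain v α≤v with Finₚ.all? (λ z → occurs C v z ≟ᵇ true)
  ... | no ¬all with Finₚ.¬∀⟶∃¬ p (λ z → occurs C v z ≡ true) (λ z → occurs C v z ≟ᵇ true) ¬all
  ...   | z , ¬oz = ℕₚ.≤-pred (count-false (occurs C v) z (¬-not ¬oz))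
  large-labels {C} chain v α≤v | yes all = contradiction
    (λ i j → Finₚ.toℕ-injective (ℕₚ.+-cancelˡ-≡ α _ _ (trans (color≡ i) (sym (color≡ j))))) (proper edge edge-ok)
    where
    face : Fin p → Face
    face z = proj₁ (occurs⁻ C (all z))
    face∈ : ∀ z → face z ∈ C
    face∈ z = proj₁ (proj₂ (occurs⁻ C (all z)))
    face-label : ∀ z → label (face z) ≡ (z , v)
    face-label z = proj₂ (proj₂ (occurs⁻ C (all z)))

    big : ∀ z → α < length (toList (face z))
    big z = ℕₚ.≰⇒> λ le →
      ℕₚ.<⇒≱ (subst (_< α) (cong proj₂ (trans (sym (label-small {face z} le)) (face-label z))) le) α≤v

    chosen≡ : ∀ z → chosen (face z) ≡ z
    chosen≡ z = cong proj₁ (trans (sym (label-large {face z} (big z))) (face-label z))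

    F : Fin p → Subset n
    F z = vertex (face z) z

    Spec : Face → Fin p → Set
    Spec X z = ∣ vertex X z ∣ ≡ k × vertex X z ⊆ₛ room (toList X) z × k ≤ s + ∣ vertex X z ∩ class (toList X) z ∣

    F-spec : ∀ z → Spec (face z) z
    F-spec z = subst (Spec (face z)) (chosen≡ z) (vertex-spec {face z} (distinct chain (face∈ z)) (big z))

    edge : Fin p → Vertex n k
    edge z = F z , proj₁ (F-spec z)

    color≡ : ∀ z → α + toℕ (c (edge z)) ≡ v
    color≡ z = begin
      α + toℕ (c (edge z))                                ≡⟨ cong (_+_ α) (color-vertex (F z) (proj₁ (F-spec z))) ⟨
      α + color (vertex (face z) z)                       ≡⟨ cong (λ y → α + color (vertex (face z) y)) (chosen≡ z) ⟨
      α + color (vertex (face z) (chosen (face z)))       ≡⟨ cong proj₂ (trans (sym (label-large {face z} (big z))) (face-label z)) ⟩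
      v                                                   ∎
      where open ≡-Reasoning

    overlap-⊆ : ∀ i j → i ≢ j → toList (face i) ⊆ toList (face j) → ∣ F i ∩ F j ∣ ≤ s
    overlap-⊆ i j i≢j Xi⊆Xj = overlap≤ s {F i} {F j} {class (toList (face i)) i}
      (ℕₚ.≤-trans (ℕₚ.≤-reflexive (proj₁ (F-spec i))) (proj₂ (proj₂ (F-spec i))))
      λ a∈ → room-avoids-class Xi⊆Xj (distinct chain (face∈ j)) i≢j (proj₁ (proj₂ (F-spec j)) a∈)

    overlaps : ∀ i j → i ≢ j → ∣ F i ∩ F j ∣ ≤ s
    overlaps i j i≢j with comparable chain (face∈ i) (face∈ j)
    ... | inj₁ i⊆j = overlap-⊆ i j i≢j i⊆j
    ... | inj₂ j⊆i = subst (λ G → ∣ G ∣ ≤ s) (∩-comm (F j) (F i)) (overlap-⊆ j i (λ j≡i → i≢j (sym j≡i)) j⊆i)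

    edge-ok : IsEdge n k s p edge
    edge-ok = small-overlap⇒IsEdge s<k edge overlaps

  ℓ : List⁺ Face → Fin p
  ℓ C = pick (m + α) (occurs (toList C)) (sign (List⁺.head C))

  ℓ-equivariant : ∀ C → ℓ (List⁺.map (List⁺.map turn) C) ≡ rot (ℓ C)
  ℓ-equivariant C = pick-rot (m + α) (occurs-turn (toList C)) (sign (List⁺.head C))

  rankᶜ : List⁺ Face → ℕ
  rankᶜ C = rank (m + α) (occurs (toList C))

  count<p : ∀ {C} → IsChain C → ∀ v → count (occurs C v) < p
  count<p chain v with ℕₚ.<-≤-connex v α
  ... | inj₁ v<α = ℕₚ.≤-<-trans (small-labels chain v v<α) 2≤p
  ... | inj₂ α≤v = s≤s (large-labels chain v α≤v)

  some-label : ∀ (C : List⁺ Face) → IsChain (toList C) → ∃ λ v → v < m + α × 0 < count (occurs (toList C) v)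
  some-label (X ∷⁺ C) chain =
    proj₂ (label X) , label<L {X} (distinct chain (here refl)) ,
    count-true (occurs (X ∷ C) (proj₂ (label X))) (proj₁ (label X)) (occurs⁺ {X ∷ C} (here refl))

  -- By `pick-cong`, different values of `ℓ` require different families of labels, and a strictly
  -- smaller family has smaller rank.
  rank-strict : ∀ C C′ → IsChain (toList C) → toList C′ ⊆ toList C → ℓ C ≢ ℓ C′ → rankᶜ C′ < rankᶜ C
  rank-strict C C′ chain C′⊆C ℓ≢ with rank-mono (m + α) (occurs-mono C′⊆C)
  ... | inj₁ lt = lt
  ... | inj₂ eq = contradiction (sym (pick-cong (m + α) eq (λ v _ → count<p chain′ v) (some-label C′ chain′) _ _)) ℓ≢
    where chain′ = IsChain-resp-⊆ C′⊆C chain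

  -- Each change of `ℓ` along the flag costs at least one unit of rank, and the last chain still has
  -- positive rank.
  flag-rank : ∀ C u → IsChain (toList C) → Flag (toList C) u →
              Repeats (map ℓ (C ∷ u)) ⊎ length (C ∷ u) ≤ rankᶜ C
  flag-rank C [] chain _ =
    let v , v<L , 0<N = some-label C chain in inj₂ (0<rank (m + α) (occurs (toList C)) v<L 0<N)
  flag-rank C (C′ ∷ u) chain (C′⊆C , flag) with flag-rank C′ u (IsChain-resp-⊆ C′⊆C chain) flag
  ... | inj₁ rep = inj₁ (there rep)
  ... | inj₂ le with ℓ C Finₚ.≟ ℓ C′
  ...   | yes eq = inj₁ (subst (λ l → Repeats (l ∷ map ℓ (C′ ∷ u))) (sym eq) here)
  ...   | no neq = inj₂ (ℕₚ.≤-trans (s≤s le) (rank-strict C C′ chain C′⊆C neq))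

  facet-distinct : ∀ {N t} → N ≤ n → Facet N t → Distinct t
  facet-distinct {zero}  {[]}    _   _ = [] , []
  facet-distinct {suc N} {v ∷ t} N<n eq =
    (All.map (λ { u<N refl → ℕₚ.<⇒≢ u<N v≡N }) bounded ∷ distinct′) ,
    (subst (_< n) (sym v≡N) N<n ∷ All.map (λ u<N → ℕₚ.<-trans u<N N<n) bounded)
    where
    v≡N : proj₁ v ≡ N
    v≡N = ∷-injectiveˡ eq
    eq′ : Facet N t
    eq′ = ∷-injectiveʳ eq
    distinct′ = proj₁ (facet-distinct (ℕₚ.<⇒≤ N<n) eq′)
    below : ∀ N (t : List (Point p)) → Facet N t → All (λ u → proj₁ u < N) t
    below zero    []      _  = []
    below (suc N) (w ∷ t) eq = s≤s (ℕₚ.≤-reflexive (∷-injectiveˡ eq)) ∷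
                               All.map ℕₚ.m<n⇒m<1+n (below N t (∷-injectiveʳ eq))
    bounded : All (λ u → proj₁ u < N) t
    bounded = below N t eq′

  flag-chain : ∀ {t} → Distinct t → ∀ s → Flag t s → IsChain s
  flag-chain {t} distinct-t s flag = record
    { distinct   = λ X∈ → AllPairs-resp-⊆ (below s flag X∈) (proj₁ distinct-t) ,
                          All-resp-⊆ (below s flag X∈) (proj₂ distinct-t)
    ; comparable = compare s flag
    }
    where
    below : ∀ {t : List (Point p)} s → Flag t s → ∀ {X} → X ∈ s → toList X ⊆ t
    below (X ∷ s) (X⊆t , flag) (here refl) = X⊆t
    below (X ∷ s) (X⊆t , flag) (there Y∈s) = ⊆-trans (below s flag Y∈s) X⊆t

    compare : ∀ {t : List (Point p)} s → Flag t s → ∀ {X Y} → X ∈ s → Y ∈ s →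
              toList X ⊆ toList Y ⊎ toList Y ⊆ toList X
    compare (X ∷ s) (_ , flag) (here refl) (here refl) = inj₁ ⊆-refl
    compare (X ∷ s) (_ , flag) (here refl) (there Y∈)  = inj₂ (below s flag Y∈)
    compare (X ∷ s) (_ , flag) (there X∈)  (here refl) = inj₁ (below s flag X∈)
    compare (X ∷ s) (_ , flag) (there X∈)  (there Y∈)  = compare s flag X∈ Y∈

  -- Otherwise the n chains of an alternating flag would need more rank than the family of labels
  -- can have.
  enough-colors : n ≤ m * q + α
  enough-colors = ℕₚ.≮⇒≥ (too-few n refl)
    where
    -- `N` stands for n so that it can be matched as a successor: the join of n copies of ℤ/p has
    -- dimension n - 1.
    too-few : ∀ N → N ≡ n → ¬ (m * q + α < N)
    too-few (suc N) refl few = alternating-flag 2≤p ℓ ℓ-equivariant N repeats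
      where
      repeats : ∀ t s u → Facet (suc N) t → Flag t s → length u ≡ suc N → Flag s u → Repeats (map ℓ u)
      repeats t s (C ∷ u) facet flag len (C⊆s , flag′) = [ (λ rep → rep) , (λ le → contradiction few (ℕₚ.≤⇒≯ (begin
        suc N                ≡⟨ len ⟨
        length (C ∷ u)       ≤⟨ le ⟩
        rankᶜ C              ≤⟨ rank≤ α m (occurs (toList C)) (small-labels chain) (large-labels chain) ⟩
        m * q + α            ∎))) ]′ (flag-rank C u chain flag′)
        where
        open ℕₚ.≤-Reasoning
        chain = IsChain-resp-⊆ C⊆s (flag-chain (facet-distinct ℕₚ.≤-refl facet) s flag)

-- Passing from factors to their product.

¬¬-∀-Subset : ∀ {n} {P : Subset n → Set} → (∀ N → ¬ ¬ P N) → ¬ ¬ (∀ N → P N)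
¬¬-∀-Subset {zero}  ¬¬P ¬all = ¬¬P [] λ P[] → ¬all λ { [] → P[] }
¬¬-∀-Subset {suc n} ¬¬P ¬all =
  ¬¬-∀-Subset (λ N → ¬¬P (inside ∷ N)) λ ins →
  ¬¬-∀-Subset (λ N → ¬¬P (outside ∷ N)) λ outs →
  ¬all λ { (inside ∷ N) → ins N ; (outside ∷ N) → outs N }

embed : ∀ {n} (N : Subset n) → Subset ∣ N ∣ → Subset n
embed []            []      = []
embed (inside  ∷ N) (b ∷ S) = b ∷ embed N S
embed (outside ∷ N) S       = outside ∷ embed N S

∣embed∣ : ∀ {n} (N : Subset n) S → ∣ embed N S ∣ ≡ ∣ S ∣
∣embed∣ []            []            = refl
∣embed∣ (inside  ∷ N) (inside  ∷ S) = cong suc (∣embed∣ N S)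
∣embed∣ (inside  ∷ N) (outside ∷ S) = ∣embed∣ N S
∣embed∣ (outside ∷ N) S             = ∣embed∣ N S

embed-∩ : ∀ {n} (N : Subset n) S T → embed N S ∩ embed N T ≡ embed N (S ∩ T)
embed-∩ []            []      []      = refl
embed-∩ (inside  ∷ N) (b ∷ S) (c ∷ T) = cong (_ ∷_) (embed-∩ N S T)
embed-∩ (outside ∷ N) S       T       = cong (outside ∷_) (embed-∩ N S T)

embed⊆ : ∀ {n} (N : Subset n) S → embed N S ⊆ₛ N
embed⊆ (inside  ∷ N) (_ ∷ S) here        = here
embed⊆ (inside  ∷ N) (b ∷ S) (there a∈)  = there (embed⊆ N S a∈)
embed⊆ (outside ∷ N) S       (there a∈)  = there (embed⊆ N S a∈)

∩-mono-∣∣ : ∀ {n} {F F′ N N′ : Subset n} → F ⊆ₛ N → F′ ⊆ₛ N′ → ∣ F ∩ F′ ∣ ≤ ∣ N ∩ N′ ∣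
∩-mono-∣∣ {F = F} {F′} F⊆N F′⊆N′ = p⊆q⇒∣p∣≤∣q∣ λ a∈ →
  let a∈F , a∈F′ = x∈p∩q⁻ F F′ a∈ in x∈p∩q⁺ (F⊆N a∈F , F′⊆N′ a∈F′)

-- The theorem for r solved for n, which avoids the ceiling and composes under products.
Bounded : ℕ → Set
Bounded r = ∀ k n s m → r * (k ∸ 1) + 1 ≤ n → s < k → (c : Vertex n k → Fin m) →
            ProperColoring n k s r m c → n ≤ m * (r ∸ 1) + r * (k ∸ s ∸ 1)

module Product
  {r₁ r₂ k n s m n₁ s₁ : ℕ} (bounded₁ : Bounded r₁) (bounded₂ : Bounded r₂) (0<r₂ : 0 < r₂)
  (s<k : s < k) (s₁<n₁ : s₁ < n₁) (s₁≤s : s₁ ≤ s)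
  (n-large : r₁ * (n₁ ∸ 1) + 1 ≤ n) (n₁-large : r₂ * (k ∸ 1) + 1 ≤ n₁)
  (n₁-few : m * (r₂ ∸ 1) + r₂ * (k ∸ s ∸ 1) < n₁)
  (c : Vertex n k → Fin m) (proper : ProperColoring n k s (r₁ * r₂) m c)
  where

  embedᵛ : (N : Subset n) → Vertex ∣ N ∣ k → Vertex n k
  embedᵛ N (S , eq) = embed N S , trans (∣embed∣ N S) eq

  MonochromaticEdge : Subset n → Set
  MonochromaticEdge N = Σ (Fin r₂ → Vertex ∣ N ∣ k) λ X →
    IsEdge ∣ N ∣ k s r₂ X × Monochromatic (λ S → c (embedᵛ N S)) X

  -- `n₁` exceeds the bound for r₂ and m colours, so `c` restricted to the k-subsets of `N` is not
  -- proper. Constructively this gives an edge only under a double negation.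
  ¬¬edge : ∀ N → ¬ ¬ (∣ N ∣ ≡ n₁ → MonochromaticEdge N)
  ¬¬edge N none = none λ { refl → contradiction n₁-few (ℕₚ.≤⇒≯
    (bounded₂ k ∣ N ∣ s m n₁-large s<k (λ S → c (embedᵛ N S)) λ X isEdge mono → none λ _ → X , isEdge , mono)) }

  module _ (edges : ∀ N → ∣ N ∣ ≡ n₁ → MonochromaticEdge N) where

    part : ∀ (N : Vertex n n₁) → Fin r₂ → Vertex n k
    part (N , eq) b = embedᵛ N (proj₁ (edges N eq) b)

    color : Vertex n n₁ → Fin m
    color N = c (part N (fromℕ< 0<r₂))

    part-color : ∀ N b → c (part N b) ≡ color N
    part-color (N , eq) b = proj₂ (proj₂ (edges N eq)) b (fromℕ< 0<r₂)

    part-overlap : ∀ N {b b′} → b ≢ b′ → ∣ proj₁ (part N b) ∩ proj₁ (part N b′) ∣ ≤ s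
    part-overlap (N , eq) {b} {b′} b≢b′ =
      let X , isEdge , _ = edges N eq
      in  ℕₚ.≤-trans (ℕₚ.≤-reflexive (trans (cong ∣_∣ (embed-∩ N (proj₁ (X b)) (proj₁ (X b′)))) (∣embed∣ N _)))
                     (proj₂ (isEdge b b′ b≢b′))

    -- A monochromatic edge of r₁ sets `N` would give r₁ r₂ k-sets of one colour. Overlaps within
    -- one `N` are controlled by the edge chosen there, overlaps across two by `s₁ ≤ s`.
    color-proper : ProperColoring n n₁ s₁ r₁ m color
    color-proper Y isEdge mono = proper Z (small-overlap⇒IsEdge s<k Z small) λ i j →
      trans (part-color _ _) (trans (mono _ _) (sym (part-color _ _)))
      where
      Z : Fin (r₁ * r₂) → Vertex n k
      Z i = let a , b = remQuot r₂ i in part (Y a) b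

      small-pairs : ∀ a b a′ b′ → (a , b) ≢ (a′ , b′) →
                    ∣ proj₁ (part (Y a) b) ∩ proj₁ (part (Y a′) b′) ∣ ≤ s
      small-pairs a b a′ b′ neq with a Finₚ.≟ a′
      ... | yes refl = part-overlap (Y a) λ b≡b′ → neq (cong (a ,_) b≡b′)
      ... | no a≢a′  = ℕₚ.≤-trans
        (∩-mono-∣∣ {F = proj₁ (part (Y a) b)} {proj₁ (part (Y a′) b′)} {proj₁ (Y a)} {proj₁ (Y a′)}
          (embed⊆ (proj₁ (Y a)) _) (embed⊆ (proj₁ (Y a′)) _))
        (ℕₚ.≤-trans (proj₂ (isEdge a a′ a≢a′)) s₁≤s)

      small : ∀ i j → i ≢ j → ∣ proj₁ (Z i) ∩ proj₁ (Z j) ∣ ≤ s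
      small i j i≢j = small-pairs _ _ _ _ λ eq → i≢j (trans (sym (Finₚ.combine-remQuot {r₁} r₂ i))
        (trans (cong (λ ab → combine (proj₁ ab) (proj₂ ab)) eq) (Finₚ.combine-remQuot {r₁} r₂ j)))

    conclusion : n ≤ m * (r₁ ∸ 1) + r₁ * (n₁ ∸ s₁ ∸ 1)
    conclusion = bounded₁ n₁ n s₁ m n-large s₁<n₁ color color-proper

  -- The goal is the negation of a strict inequality, so double negations are harmless; there being
  -- finitely many `N`, the edges can be assumed for all of them at once.
  product-bound : n ≤ m * (r₁ ∸ 1) + r₁ * (n₁ ∸ s₁ ∸ 1)
  product-bound = ℕₚ.≮⇒≥ λ few → ¬¬-∀-Subset ¬¬edge λ edges → ℕₚ.<⇒≱ few (conclusion edges)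

private
  s≤r*[k-1] : ∀ {r k s} → 0 < r → s < k → s ≤ r * (k ∸ 1)
  s≤r*[k-1] {suc r} {suc k} _ (s≤s s≤k) = ℕₚ.≤-trans s≤k (ℕₚ.m≤m+n k (r * k))

  -- For positive s and d₁ this is m / s < 1 + 1 / d₂ ≤ 1 + 1 / d₁. With m = s + d the hypothesis
  -- says d d₂ < s.
  weighted : ∀ m s d₁ d₂ → d₁ ≤ d₂ → m * d₂ < suc d₂ * s → m * d₁ ≤ suc d₁ * s
  weighted m s d₁ d₂ d₁≤d₂ lt with ℕₚ.≤-total m s
  ... | inj₁ m≤s = ℕₚ.≤-trans (ℕₚ.*-monoˡ-≤ d₁ m≤s) (ℕₚ.≤-trans (ℕₚ.≤-reflexive (ℕₚ.*-comm s d₁)) (ℕₚ.m≤n+m (d₁ * s) s))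
  ... | inj₂ s≤m with ℕₚ.m≤n⇒∃[o]m+o≡n s≤m
  ...   | d , refl = begin
    (s + d) * d₁      ≡⟨ expand s d d₁ ⟩
    d * d₁ + d₁ * s   ≤⟨ ℕₚ.+-monoˡ-≤ (d₁ * s) (ℕₚ.≤-trans (ℕₚ.*-monoʳ-≤ d d₁≤d₂) d*d₂≤s) ⟩
    suc d₁ * s        ∎
    where
    open ℕₚ.≤-Reasoning
    expand : ∀ s d e → (s + d) * e ≡ d * e + e * s
    expand = ring-ℕ
    d*d₂≤s : d * d₂ ≤ s
    d*d₂≤s = ℕₚ.<⇒≤ (ℕₚ.+-cancelʳ-< (d₂ * s) (d * d₂) s (subst (_< suc d₂ * s) (expand s d d₂) lt))

-- If the size needed for N falls below the range of validity of the bound for r₂, then N may be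
-- taken of size r₂ (k − 1) + 1, and overlaps of size s between different N are affordable.
product-Bounded : ∀ {r₁ r₂} → 0 < r₁ → r₁ ≤ r₂ → Bounded r₁ → Bounded r₂ → Bounded (r₁ * r₂)
product-Bounded {suc d₁} {suc d₂} _ (s≤s d₁≤d₂) bounded₁ bounded₂ k n s m n-large s<k c proper
  with ℕₚ.≤-<-connex (suc d₂ * (k ∸ 1)) (m * d₂ + suc d₂ * (k ∸ s ∸ 1))
-- Sets `N` of size β + 1 that are pairwise disjoint: substituting the bound for r₂ into the bound
-- for r₁ gives exactly the bound for the product.
... | inj₁ γ≤β = ℕₚ.≮⇒≥ λ few → ℕₚ.<⇒≱ few (ℕₚ.≤-trans
      (Product.product-bound {n₁ = suc β} {0} bounded₁ bounded₂ (s≤s z≤n) s<k (s≤s z≤n) z≤n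
      (begin
        r₁ * β + 1              ≡⟨ ℕₚ.+-comm (r₁ * β) 1 ⟩
        suc (r₁ * β)            ≤⟨ s≤s (ℕₚ.m≤n+m (r₁ * β) (m * d₁)) ⟩
        suc (m * d₁ + r₁ * β)   ≡⟨ cong suc regroup ⟩
        suc _                   ≤⟨ few ⟩
        n                       ∎)
      (ℕₚ.≤-trans (ℕₚ.≤-reflexive (ℕₚ.+-comm _ 1)) (s≤s γ≤β)) (ℕₚ.n<1+n β) c proper)
      (ℕₚ.≤-reflexive regroup))
  where
  open ℕₚ.≤-Reasoning
  r₁ r₂ e β : ℕ
  r₁ = suc d₁
  r₂ = suc d₂
  e = k ∸ s ∸ 1
  β = m * d₂ + r₂ * e
  regroup : m * d₁ + r₁ * β ≡ m * (r₁ * r₂ ∸ 1) + r₁ * r₂ * e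
  regroup = lemma m d₁ d₂ e
    where
    lemma : ∀ m d₁ d₂ e → m * d₁ + (1 + d₁) * (m * d₂ + (1 + d₂) * e) ≡
                          m * (d₂ + d₁ * (1 + d₂)) + (1 + d₁) * (1 + d₂) * e
    lemma = ring-ℕ
-- This case cannot occur: β < γ forces m (r₂ - 1) < r₂ s, hence m (r₁ - 1) ≤ r₁ s as r₁ ≤ r₂, and
-- the bound for r₁ puts n at or below r₁ r₂ (k - 1).
... | inj₂ β<γ = contradiction n-large (ℕₚ.<⇒≱ (begin-strict
      n                            ≤⟨ bound ⟩
      m * d₁ + r₁ * (γ ∸ s)        ≤⟨ ℕₚ.+-monoˡ-≤ (r₁ * (γ ∸ s)) (weighted m s d₁ d₂ d₁≤d₂ m*d₂<) ⟩
      r₁ * s + r₁ * (γ ∸ s)        ≡⟨ ℕₚ.*-distribˡ-+ r₁ s (γ ∸ s) ⟨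
      r₁ * (s + (γ ∸ s))           ≡⟨ cong (r₁ *_) (ℕₚ.m+[n∸m]≡n s≤γ) ⟩
      r₁ * γ                       <⟨ ℕₚ.n<1+n _ ⟩
      suc (r₁ * γ)                 ≡⟨ ℕₚ.+-comm 1 (r₁ * γ) ⟩
      r₁ * γ + 1                   ≡⟨ cong (_+ 1) (sym (ℕₚ.*-assoc r₁ r₂ (k ∸ 1))) ⟩
      r₁ * r₂ * (k ∸ 1) + 1        ∎))
  where
  open ℕₚ.≤-Reasoning
  r₁ r₂ e γ : ℕ
  r₁ = suc d₁
  r₂ = suc d₂
  e = k ∸ s ∸ 1
  γ = r₂ * (k ∸ 1)
  s≤γ : s ≤ γ
  s≤γ = s≤r*[k-1] {r₂} (s≤s z≤n) s<k
  e+s : e + s ≡ k ∸ 1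
  e+s = begin-equality
    k ∸ s ∸ 1 + s   ≡⟨ cong (_+ s) (trans (ℕₚ.∸-+-assoc k s 1)
                         (trans (cong (k ∸_) (ℕₚ.+-comm s 1)) (sym (ℕₚ.∸-+-assoc k 1 s)))) ⟩
    k ∸ 1 ∸ s + s   ≡⟨ ℕₚ.m∸n+n≡m (ℕₚ.∸-monoˡ-≤ 1 s<k) ⟩
    k ∸ 1           ∎
  m*d₂< : m * d₂ < r₂ * s
  m*d₂< = ℕₚ.+-cancelʳ-< (r₂ * e) (m * d₂) (r₂ * s) (begin-strict
    m * d₂ + r₂ * e   <⟨ β<γ ⟩
    r₂ * (k ∸ 1)      ≡⟨ cong (r₂ *_) e+s ⟨
    r₂ * (e + s)      ≡⟨ ℕₚ.*-distribˡ-+ r₂ e s ⟩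
    r₂ * e + r₂ * s   ≡⟨ ℕₚ.+-comm (r₂ * e) (r₂ * s) ⟩
    r₂ * s + r₂ * e   ∎)
  bound : n ≤ m * d₁ + r₁ * (γ ∸ s)
  bound = subst (λ x → n ≤ m * d₁ + r₁ * x) (trans (ℕₚ.∸-+-assoc (suc γ) s 1) (cong (suc γ ∸_) (ℕₚ.+-comm s 1)))
    (Product.product-bound {n₁ = suc γ} {s} bounded₁ bounded₂ (s≤s z≤n) s<k (s≤s s≤γ) ℕₚ.≤-refl
      (subst (λ x → x + 1 ≤ n) (ℕₚ.*-assoc r₁ r₂ (k ∸ 1)) n-large)
      (ℕₚ.≤-reflexive (ℕₚ.+-comm γ 1)) (ℕₚ.m<n⇒m<1+n β<γ) c proper)

-- Induction over factorisations, and the ceiling.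

prime-Bounded : ∀ {p} → Prime p → Bounded p
prime-Bounded {suc q} p-prime k n s m n-large s<k c proper =
  PrimeCase.enough-colors q p-prime k n s m n-large s<k c proper

all-Bounded : ∀ r → 2 ≤ r → Bounded r
all-Bounded = <-rec (λ r → 2 ≤ r → Bounded r) step
  where
  cofactor : ∀ {d} e → d < e * d → 2 ≤ e
  cofactor {d} (suc zero)    d<d = contradiction d<d (ℕₚ.<-irrefl (sym (ℕₚ.*-identityˡ d)))
  cofactor     (suc (suc e)) _   = s≤s (s≤s z≤n)

  factors : ∀ {d e} → 2 ≤ d → 2 ≤ e → d < e * d → (∀ {f} → f < e * d → 2 ≤ f → Bounded f) → Bounded (e * d)
  factors {d@(suc _)} {e@(suc _)} 2≤d 2≤e d<ed rec with ℕₚ.≤-total e d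
  ... | inj₁ e≤d = product-Bounded (ℕₚ.<⇒≤ 2≤e) e≤d (rec (ℕₚ.m<m*n e d 2≤d) 2≤e) (rec d<ed 2≤d)
  ... | inj₂ d≤e = subst Bounded (ℕₚ.*-comm d e)
    (product-Bounded (ℕₚ.<⇒≤ 2≤d) d≤e (rec d<ed 2≤d) (rec (ℕₚ.m<m*n e d 2≤d) 2≤e))

  step : ∀ r → (∀ {d} → d < r → 2 ≤ d → Bounded d) → 2 ≤ r → Bounded r
  step r rec 2≤r with prime? r
  ... | yes r-prime = prime-Bounded r-prime
  ... | no ¬prime with ¬prime⇒composite {{n>1⇒nonTrivial 2≤r}} ¬prime
  ...   | composite {d} d<r (divides e refl) = factors (nonTrivial⇒n>1 d) (cofactor e d<r) d<r rec

theorem1 : (k n r s : ℕ) → r * (k ∸ 1) + 1 ≤ n → s < k → 2 ≤ r →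
    ChromaticAtLeast n k s r (ceilDiv (n ∸ r * (k ∸ s ∸ 1)) (r ∸ 2))
theorem1 k n (suc (suc r)) s n-large s<k 2≤r@(s≤s (s≤s _)) m c proper = ℕₚ.≮⇒≥ λ m<b → ℕₚ.<⇒≱ (few m<b)
  (ℕₚ.m≤n+o⇒m∸n≤o n α (ℕₚ.≤-trans (all-Bounded (suc (suc r)) 2≤r k n s m n-large s<k c proper)
                                     (ℕₚ.≤-reflexive (ℕₚ.+-comm _ α))))
  where
  open ℕₚ.≤-Reasoning
  α = suc (suc r) * (k ∸ s ∸ 1)
  -- Here `r` is two less than the uniformity, so the divisor is `suc r`, and adding `r` before
  -- dividing is the rounding up.
  few : m < (n ∸ α + r) / suc r → m * suc r < n ∸ α
  few m<b = ℕₚ.+-cancelʳ-< r (m * suc r) (n ∸ α) (begin-strict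
    m * suc r + r                   <⟨ ℕₚ.+-monoʳ-< (m * suc r) (ℕₚ.n<1+n r) ⟩
    m * suc r + suc r               ≡⟨ ℕₚ.+-comm (m * suc r) (suc r) ⟩
    suc m * suc r                   ≤⟨ ℕₚ.*-monoˡ-≤ (suc r) m<b ⟩
    (n ∸ α + r) / suc r * suc r     ≤⟨ m/n*n≤m (n ∸ α + r) (suc r) ⟩
    n ∸ α + r                       ∎)
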